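{- Let $\{a_n\}_{n\ge 0}$ be a sequence of real numbers, with $a_n\neq 0$ for all sufficiently large $n$, such that, as $n\to\infty$, \[ \frac{a_{n-1}a_{n+1}}{a_n^2} = 1+\sum_{i=1}^m \frac{r_i(\log n)}{n^{\alpha_i}} + o\left(\frac{1}{n^{\beta}}\right), \] where $m\ge 1$ is an integer, $\alpha_1,\dots,\alpha_m,\beta$ are real numbers with $0<\alpha_1<\alpha_2<\cdots<\alpha_m<\beta$, and $r_1(x),\dots,r_m(x)$ are rational functions of $x$ with real coefficients. Assume that $\alpha_m-\alpha_1\ge 1$. If either (i) $0<\alpha_1<2$ and $r_1(x)<0$ for all sufficiently large $x$, or (ii) $\alpha_1=2$ and $r_1(x)<-1$ for all sufficiently large $x$, then $\{a_n\}_{n\ge 0}$ satisfies the higher order Turán inequalities asymptotically.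
   Context: A real sequence $\{a_n\}_{n\ge 0}$ satisfies the higher order Turán inequalities asymptotically if \[ 4(a_n^2-a_{n-1}a_{n+1})(a_{n+1}^2-a_na_{n+2})-(a_na_{n+1}-a_{n-1}a_{n+2})^2\ge 0 \] holds for all sufficiently large $n$. -}

module Defs where

open import Algebra.Bundles using (CommutativeRing; module Semiring)
import Algebra.Definitions.RawSemiring as RawSemiringDefinitions
open import Data.Fin.Base using (Fin)
open import Data.List.Base using (List; foldr)
open import Data.List.Relation.Unary.Any using (Any)
open import Data.Nat.Base as ℕ using (ℕ; _∸_)
open import Data.Product.Base using (∃; ∃-syntax; _×_)
open import Data.Sum.Base using ([_,_]′)
open import Level as Level using (0ℓ)
open import Relation.Binary.Core using (Rel)
open import Relation.Binary.Structures using (IsTotalOrder)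
open import Relation.Nullary.Negation using (¬_)
open import Relation.Unary using (Pred)

-- The real numbers, axiomatised as a Dedekind-complete ordered field.  Over a
-- classical metatheory these axioms determine ℝ up to unique isomorphism.
record RealNumbers : Set (Level.suc 0ℓ) where
  infix  4 _≤_ _<_
  infix  8 _⁻¹
  infixl 7 _/_

  field
    commutativeRing : CommutativeRing 0ℓ 0ℓ

  open CommutativeRing commutativeRing public
    renaming (Carrier to ℝ)

  field
    _≤_ : Rel ℝ 0ℓ
    -- Inversion is total; its value at 0 is left unspecified.
    _⁻¹ : ℝ → ℝ

  _<_ : Rel ℝ 0ℓ
  x < y = x ≤ y × x ≉ y

  UpperBound : Pred ℝ 0ℓ → Pred ℝ 0ℓ
  UpperBound P u = ∀ x → P x → x ≤ u

  field
    0≉1          : 0# ≉ 1#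
    ⁻¹-inverse   : ∀ x → x ≉ 0# → x * x ⁻¹ ≈ 1#
    isTotalOrder : IsTotalOrder _≈_ _≤_
    +-monoˡ-≤    : ∀ x y z → x ≤ y → x + z ≤ y + z
    *-nonNeg     : ∀ x y → 0# ≤ x → 0# ≤ y → 0# ≤ x * y
    supremum     : (P : Pred ℝ 0ℓ) → ∃ P → ∃ (UpperBound P) →
                   ∃[ s ] UpperBound P s × (∀ u → UpperBound P u → s ≤ u)

  open IsTotalOrder isTotalOrder public
    using (total; antisym)
    renaming (refl to ≤-refl; trans to ≤-trans; reflexive to ≤-reflexive)

  open RawSemiringDefinitions (Semiring.rawSemiring semiring) public
    using (_^_; sum)

  _/_ : ℝ → ℝ → ℝ
  x / y = x * y ⁻¹

  ∣_∣ : ℝ → ℝ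
  ∣ x ∣ = [ (λ _ → x) , (λ _ → - x) ]′ (total 0# x)

  fromℕ : ℕ → ℝ
  fromℕ n = RawSemiringDefinitions._×_ (Semiring.rawSemiring semiring) n 1#

  Eventually : Pred ℕ 0ℓ → Set
  Eventually P = ∃[ N ] (∀ n → N ℕ.≤ n → P n)

  EventuallyReal : Pred ℝ 0ℓ → Set
  EventuallyReal P = ∃[ X ] (∀ x → X ≤ x → P x)

  infix 4 _⟶_ _=o_

  _⟶_ : (ℕ → ℝ) → ℝ → Set
  s ⟶ l = ∀ ε → 0# < ε → Eventually (λ n → ∣ s n - l ∣ < ε)

  _=o_ : Rel (ℕ → ℝ) 0ℓ
  f =o g = ∀ ε → 0# < ε → Eventually (λ n → ∣ f n ∣ ≤ ε * ∣ g n ∣)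

  -- Coefficients are listed from the constant term upwards.
  Polynomial : Set
  Polynomial = List ℝ

  evalPoly : Polynomial → ℝ → ℝ
  evalPoly p x = foldr (λ c v → c + x * v) 0# p

  -- Fractions of polynomials; different fractions may represent the same
  -- rational function, and agree for all sufficiently large arguments if so.
  record RationalFunction : Set where
    field
      numerator   : Polynomial
      denominator : Polynomial
      nonzero     : Any (_≉ 0#) denominator

  eval : RationalFunction → ℝ → ℝ
  eval r x = evalPoly numerator x / evalPoly denominator x
    where open RationalFunction r

  -- The exponential function as Euler's limit, and the natural logarithm as
  -- its inverse on the positive reals (unspecified elsewhere).  Both are
  -- uniquely determined on their domains.
  record ExpLog : Set where
    field
      exp       : ℝ → ℝ
      log       : ℝ → ℝ
      exp-limit : ∀ x → (λ n → (1# + x / fromℕ n) ^ n) ⟶ exp x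
      exp-log   : ∀ x → 0# < x → exp (log x) ≈ x

    -- Real powers of a positive base.
    infixr 8 _^ʳ_
    _^ʳ_ : ℝ → ℝ → ℝ
    x ^ʳ α = exp (α * log x)

  -- The index n ∸ 1 is the intended n - 1 for all n ≥ 1, and only large n
  -- matter.
  SatisfiesHigherOrderTuránAsymptotically : (ℕ → ℝ) → Set
  SatisfiesHigherOrderTuránAsymptotically a = Eventually λ n →
    0# ≤ fromℕ 4 * ((a n ^ 2 - a (n ∸ 1) * a (n ℕ.+ 1))
                    * (a (n ℕ.+ 1) ^ 2 - a n * a (n ℕ.+ 2)))
         - (a n * a (n ℕ.+ 1) - a (n ∸ 1) * a (n ℕ.+ 2)) ^ 2

  -- a(n-1) a(n+1) / a(n)² = 1 + Σ_i r_i(log n) / n^(α_i) + o(1 / n^β)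
  RatioExpansion : ExpLog → (ℕ → ℝ) → (m : ℕ) →
                   (Fin m → RationalFunction) → (Fin m → ℝ) → ℝ → Set
  RatioExpansion E a m r α β =
    (λ n → (a (n ∸ 1) * a (n ℕ.+ 1)) / (a n ^ 2)
           - (1# + sum (λ i → eval (r i) (log (fromℕ n)) / (fromℕ n ^ʳ α i))))
    =o (λ n → 1# / (fromℕ n ^ʳ β))
    where open ExpLog E

module Submission where

-- Let x = 1 - a(n-1) a(n+1) / a(n)² and let y be its successor.  Divided by
-- (a(n) a(n+1))², the Turán expression becomes
--   4 x y - (x + y - x y)² = x y (2 (x + y) - x y) - (x - y)²,
-- so x - y has to be small against 2 x^(3/2).  Write x = X / n^α₁.  The
-- expansion gives X = ρ up to a relative error that is a negative power of n,
-- where ρ = - r₁(log n), and since α_m - α₁ ≥ 1 the same holds for n times the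
-- increments, so that n (x - y) = (α₁ ρ + n Δρ) / n^α₁ up to such an error.  The
-- claim thus reduces to (α₁ ρ + n Δρ)² < 4 n^(2 - α₁) ρ³.  A rational function of
-- log n satisfies |n Δr| ≤ ε |r|, so a power of n decides the case α₁ < 2.  For
-- α₁ = 2 put ρ = 1 + δ; then 4 ρ³ - (2 ρ + n Δρ)² = 4 ρ² δ - 4 ρ n Δδ - (n Δδ)² is
-- positive since |n Δδ| ≤ δ / 2, and it dominates every negative power of n.

open import Defs
open import Algebra.Bundles using (CommutativeRing)
import Algebra.Properties.AbelianGroup
import Algebra.Properties.CommutativeSemiring.Exp
import Algebra.Properties.Ring
import Algebra.Properties.Semiring.Mult.TCOptimised
import Algebra.Properties.Semiring.Sum
import Algebra.Solver.Ring
open import Algebra.Solver.Ring.AlmostCommutativeRing using (_-Raw-AlmostCommutative⟶_; fromCommutativeRing)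
open import Axiom.ExcludedMiddle using (ExcludedMiddle)
open import Data.Fin.Base as Fin using (Fin)
open import Data.Integer.Base as ℤ using (ℤ; +_; -[1+_])
import Data.Integer.Properties as ℤ
open import Data.List.Base using ([]; _∷_)
open import Data.List.Relation.Unary.Any using (Any; here; there)
open import Data.Maybe.Base using (Maybe; just; nothing)
open import Data.Nat.Base as ℕ using (ℕ; zero; suc)
import Data.Nat.Properties as ℕ
open import Data.Product.Base using (∃; ∃-syntax; _×_; _,_; proj₁; proj₂)
import Data.Sign.Base as Sign
open import Data.Sum.Base using (_⊎_; inj₁; inj₂; [_,_]′)
open import Function.Base using (_∘_)
open import Level using (0ℓ)
open import Relation.Binary.PropositionalEquality as ≡ using (_≡_)
import Relation.Binary.Reasoning.Setoid
open import Relation.Binary.Structures using (IsTotalOrder)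
open import Relation.Nullary using (¬_; yes; no; contradiction)

-- A rational function of log n may tend to 0 or to infinity, so ρ need not have a limit by which to
-- divide. Instead ρ is held between n^(-ε) and n^ε for every ε > 0, while each error is kept below
-- n^(-γ) for one fixed γ > 0; any such error loses against any such main term, and sums, products
-- and shifts respect the scheme. Nothing is known about the increments of the o-term, so n times an
-- increment can only be bounded by n times the size of the term. This costs a full power of n,
-- which is what the gap α_m - α₁ ≥ 1 pays for. Derivatives are replaced throughout. The exponential
-- is given only as Euler's limit; the functional equation and 1 + x ≤ exp x are extracted from it,
-- and together they yield tangent-line bounds for exp, for log and for real powers. The threshold
-- -1 of the critical case comes from 4 ρ³ = (2 ρ)² at ρ = 1: there the two sides of the reduced
-- inequality meet, and the margin is only of the order of δ, which may tend to 0.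

-- A ring solver with integer coefficients

module IntegerCoefficients {c ℓ} (R : CommutativeRing c ℓ) where

  open CommutativeRing R
  open Algebra.Properties.Ring ring using (-‿distribˡ-*; -‿distribʳ-*; -‿involutive; -0#≈0#)
  open Algebra.Properties.AbelianGroup +-abelianGroup using (⁻¹-∙-comm)
  open Algebra.Properties.Semiring.Mult.TCOptimised semiring
    using (×-homo-+; ×1-homo-*; 1+×) renaming (_×_ to _×′_)
  open Relation.Binary.Reasoning.Setoid setoid

  -- The optimised multiples make `fromℤ (+ 1)` and `fromℤ (+ 2)` unfold to `1#` and `1# + 1#`, so
  -- that constants in solver goals match the terms as they are written.
  fromℤ : ℤ → Carrier
  fromℤ (+ n)    = n ×′ 1#
  fromℤ -[1+ n ] = - (suc n ×′ 1#)

  fromℤ-⊖ : ∀ m n → fromℤ (m ℤ.⊖ n) ≈ m ×′ 1# - n ×′ 1#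
  fromℤ-⊖ zero    zero    = sym (-‿inverseʳ 0#)
  fromℤ-⊖ zero    (suc n) = sym (+-identityˡ _)
  fromℤ-⊖ (suc m) zero    = sym (trans (+-congˡ -0#≈0#) (+-identityʳ _))
  fromℤ-⊖ (suc m) (suc n) = begin
    fromℤ (suc m ℤ.⊖ suc n)                ≡⟨ ≡.cong fromℤ (ℤ.[1+m]⊖[1+n]≡m⊖n m n) ⟩
    fromℤ (m ℤ.⊖ n)                        ≈⟨ fromℤ-⊖ m n ⟩
    m ×′ 1# - n ×′ 1#                      ≈⟨ +-congʳ (+-identityˡ _) ⟨
    0# + m ×′ 1# - n ×′ 1#                 ≈⟨ +-congʳ (+-congʳ (-‿inverseʳ 1#)) ⟨
    1# - 1# + m ×′ 1# - n ×′ 1#            ≈⟨ +-congʳ (+-assoc _ _ _) ⟩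
    1# + (- 1# + m ×′ 1#) - n ×′ 1#        ≈⟨ +-congʳ (+-congˡ (+-comm _ _)) ⟩
    1# + (m ×′ 1# - 1#) - n ×′ 1#          ≈⟨ +-congʳ (+-assoc _ _ _) ⟨
    1# + m ×′ 1# - 1# - n ×′ 1#            ≈⟨ +-assoc _ _ _ ⟩
    1# + m ×′ 1# + (- 1# - n ×′ 1#)        ≈⟨ +-congˡ (⁻¹-∙-comm 1# (n ×′ 1#)) ⟩
    1# + m ×′ 1# - (1# + n ×′ 1#)          ≈⟨ +-cong (1+× m 1#) (-‿cong (1+× n 1#)) ⟨
    suc m ×′ 1# - suc n ×′ 1#              ∎

  fromℤ-+ : ∀ i j → fromℤ (i ℤ.+ j) ≈ fromℤ i + fromℤ j
  fromℤ-+ (+ m)    (+ n)    = ×-homo-+ 1# m n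
  fromℤ-+ (+ m)    -[1+ n ] = fromℤ-⊖ m (suc n)
  fromℤ-+ -[1+ m ] (+ n)    = trans (fromℤ-⊖ n (suc m)) (+-comm _ _)
  fromℤ-+ -[1+ m ] -[1+ n ] = begin
    - (suc (suc (m ℕ.+ n)) ×′ 1#)        ≡⟨ ≡.cong (λ k → - (suc k ×′ 1#)) (ℕ.+-suc m n) ⟨
    - ((suc m ℕ.+ suc n) ×′ 1#)          ≈⟨ -‿cong (×-homo-+ 1# (suc m) (suc n)) ⟩
    - (suc m ×′ 1# + suc n ×′ 1#)        ≈⟨ ⁻¹-∙-comm _ _ ⟨
    - (suc m ×′ 1#) - (suc n ×′ 1#)      ∎

  fromℤ-+◃ : ∀ n → fromℤ (Sign.+ ℤ.◃ n) ≈ n ×′ 1#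
  fromℤ-+◃ zero    = refl
  fromℤ-+◃ (suc n) = refl

  fromℤ--◃ : ∀ n → fromℤ (Sign.- ℤ.◃ n) ≈ - (n ×′ 1#)
  fromℤ--◃ zero    = sym -0#≈0#
  fromℤ--◃ (suc n) = refl

  fromℤ-* : ∀ i j → fromℤ (i ℤ.* j) ≈ fromℤ i * fromℤ j
  fromℤ-* (+ m)    (+ n)    = trans (fromℤ-+◃ (m ℕ.* n)) (×1-homo-* m n)
  fromℤ-* (+ m)    -[1+ n ] = begin
    fromℤ (Sign.- ℤ.◃ (m ℕ.* suc n))   ≈⟨ fromℤ--◃ (m ℕ.* suc n) ⟩
    - ((m ℕ.* suc n) ×′ 1#)            ≈⟨ -‿cong (×1-homo-* m (suc n)) ⟩
    - (m ×′ 1# * suc n ×′ 1#)          ≈⟨ -‿distribʳ-* _ _ ⟩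
    m ×′ 1# * - (suc n ×′ 1#)          ∎
  fromℤ-* -[1+ m ] (+ n)    = begin
    fromℤ (Sign.- ℤ.◃ (suc m ℕ.* n))   ≈⟨ fromℤ--◃ (suc m ℕ.* n) ⟩
    - ((suc m ℕ.* n) ×′ 1#)            ≈⟨ -‿cong (×1-homo-* (suc m) n) ⟩
    - (suc m ×′ 1# * n ×′ 1#)          ≈⟨ -‿distribˡ-* _ _ ⟩
    - (suc m ×′ 1#) * n ×′ 1#          ∎
  fromℤ-* -[1+ m ] -[1+ n ] = begin
    (suc m ℕ.* suc n) ×′ 1#              ≈⟨ ×1-homo-* (suc m) (suc n) ⟩
    suc m ×′ 1# * suc n ×′ 1#            ≈⟨ -‿involutive _ ⟨
    - - (suc m ×′ 1# * suc n ×′ 1#)      ≈⟨ -‿cong (-‿distribˡ-* _ _) ⟩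
    - (- (suc m ×′ 1#) * suc n ×′ 1#)    ≈⟨ -‿distribʳ-* _ _ ⟩
    - (suc m ×′ 1#) * - (suc n ×′ 1#)    ∎

  fromℤ-neg : ∀ i → fromℤ (ℤ.- i) ≈ - fromℤ i
  fromℤ-neg (+ zero)  = sym -0#≈0#
  fromℤ-neg (+ suc n) = refl
  fromℤ-neg -[1+ n ]  = sym (-‿involutive _)

  homomorphism : ℤ.+-*-rawRing -Raw-AlmostCommutative⟶ fromCommutativeRing R
  homomorphism = record
    { ⟦_⟧    = fromℤ
    ; +-homo = fromℤ-+
    ; *-homo = fromℤ-*
    ; -‿homo = fromℤ-neg
    ; 0-homo = refl
    ; 1-homo = refl
    }

  fromℤ-≟ : ∀ i j → Maybe (fromℤ i ≈ fromℤ j)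
  fromℤ-≟ i j with i ℤ.≟ j
  ... | yes i≡j = just (reflexive (≡.cong fromℤ i≡j))
  ... | no  _   = nothing

  open Algebra.Solver.Ring ℤ.+-*-rawRing (fromCommutativeRing R) homomorphism fromℤ-≟ public
    using (solve; _:=_; _:+_; _:*_; _:-_; :-_; _:^_; con)

-- Ordered field, absolute value, Archimedean property

module OrderedField (em : ExcludedMiddle 0ℓ) (R : RealNumbers) where

  open RealNumbers R
  open IntegerCoefficients commutativeRing public
  open IsTotalOrder isTotalOrder public using () renaming (≤-resp-≈ to ≤-resp₂-≈)

  2# : ℝ
  2# = 1# + 1#

  ≤-respˡ-≈ : ∀ {x y z} → x ≈ y → x ≤ z → y ≤ z
  ≤-respˡ-≈ = proj₂ ≤-resp₂-≈

  ≤-respʳ-≈ : ∀ {x y z} → x ≈ y → z ≤ x → z ≤ y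
  ≤-respʳ-≈ = proj₁ ≤-resp₂-≈

  ≤⇒0≤- : ∀ {x y} → x ≤ y → 0# ≤ y - x
  ≤⇒0≤- {x} {y} x≤y = ≤-respˡ-≈ (-‿inverseʳ x) (+-monoˡ-≤ x y (- x) x≤y)

  -- Most inequalities below are obtained from a certificate: a combination c of
  -- products of nonnegative terms that the ring solver identifies with y - x.
  ≤-by : ∀ {x y c} → 0# ≤ c → y - x ≈ c → x ≤ y
  ≤-by {x} {y} 0≤c y-x≈c =
    ≤-respˡ-≈ (+-identityˡ x)
      (≤-respʳ-≈ (solve 2 (λ x y → x :- y :+ y := x) refl y x) (+-monoˡ-≤ 0# (y - x) x
              (≤-respʳ-≈ (sym y-x≈c) 0≤c)))

  0≤-by : ∀ {x c} → 0# ≤ c → x ≈ c → 0# ≤ x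
  0≤-by 0≤c x≈c = ≤-respʳ-≈ (sym x≈c) 0≤c

  0≤+ : ∀ {x y} → 0# ≤ x → 0# ≤ y → 0# ≤ x + y
  0≤+ {x} {y} 0≤x 0≤y = ≤-trans 0≤y (≤-by 0≤x (solve 2 (λ x y → x :+ y :- y := x) refl x y))

  0≤* : ∀ {x y} → 0# ≤ x → 0# ≤ y → 0# ≤ x * y
  0≤* = *-nonNeg _ _

  0≤x*x : ∀ x → 0# ≤ x * x
  0≤x*x x with total 0# x
  ... | inj₁ 0≤x = 0≤* 0≤x 0≤x
  ... | inj₂ x≤0 = 0≤-by (0≤* (≤⇒0≤- x≤0) (≤⇒0≤- x≤0))
          (solve 1 (λ x → x :* x := (con (+ 0) :- x) :* (con (+ 0) :- x)) refl x)

  0≤1 : 0# ≤ 1#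
  0≤1 = 0≤-by (0≤x*x 1#) (solve 1 (λ x → con (+ 1) := con (+ 1) :* con (+ 1)) refl 0#)

  0≤ℕ : ∀ n → 0# ≤ fromℤ (+ n)
  0≤ℕ zero          = ≤-refl
  0≤ℕ (suc zero)    = 0≤1
  0≤ℕ (suc (suc n)) = 0≤+ (0≤ℕ (suc n)) 0≤1

  ≈⇒≤ : ∀ {x y} → x ≈ y → x ≤ y
  ≈⇒≤ = ≤-reflexive

  ≈⇒≥ : ∀ {x y} → x ≈ y → y ≤ x
  ≈⇒≥ = ≤-reflexive ∘ sym

  0<1 : 0# < 1#
  0<1 = 0≤1 , 0≉1

  <⇒≤ : ∀ {x y} → x < y → x ≤ y
  <⇒≤ = proj₁

  <⇒≱ : ∀ {x y} → x < y → ¬ y ≤ x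
  <⇒≱ (x≤y , x≉y) y≤x = x≉y (antisym x≤y y≤x)

  ≰⇒> : ∀ {x y} → ¬ x ≤ y → y < x
  ≰⇒> {x} {y} x≰y with total x y
  ... | inj₁ x≤y = contradiction x≤y x≰y
  ... | inj₂ y≤x = y≤x , λ y≈x → x≰y (≈⇒≥ y≈x)

  ≮⇒≥ : ∀ {x y} → ¬ x < y → y ≤ x
  ≮⇒≥ {x} {y} x≮y with total y x
  ... | inj₁ y≤x = y≤x
  ... | inj₂ x≤y with em {x ≈ y}
  ...   | yes x≈y = ≈⇒≥ x≈y
  ...   | no  x≉y = contradiction (x≤y , x≉y) x≮y

  <-≤-trans : ∀ {x y z} → x < y → y ≤ z → x < z
  <-≤-trans x<y y≤z = ≰⇒> λ z≤x → <⇒≱ x<y (≤-trans y≤z z≤x)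

  ≤-<-trans : ∀ {x y z} → x ≤ y → y < z → x < z
  ≤-<-trans x≤y y<z = ≰⇒> λ z≤x → <⇒≱ y<z (≤-trans z≤x x≤y)

  0<⇒≉0 : ∀ {x} → 0# < x → x ≉ 0#
  0<⇒≉0 (_ , 0≉x) x≈0 = 0≉x (sym x≈0)

  <⇒0<- : ∀ {x y} → x < y → 0# < y - x
  <⇒0<- {x} {y} x<y = ≰⇒> λ y-x≤0 → <⇒≱ x<y (≤-by (≤⇒0≤- y-x≤0)
          (solve 2 (λ x y → x :- y := con (+ 0) :- (y :- x)) refl x y))

  0<-⇒< : ∀ {x y} → 0# < y - x → x < y
  0<-⇒< {x} {y} 0<y-x = ≰⇒> λ y≤x → <⇒≱ 0<y-x (≤-by (≤⇒0≤- y≤x)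
          (solve 2 (λ x y → con (+ 0) :- (x :- y) := y :- x) refl y x))

  *-cancel-≉0 : ∀ {x y} → x ≉ 0# → x * y ≈ 0# → y ≈ 0#
  *-cancel-≉0 {x} {y} x≉0 xy≈0 = trans (sym (*-identityˡ y))
    (trans (*-congʳ (sym (⁻¹-inverse x x≉0)))
    (trans (solve 3 (λ x y z → x :* y :* z := y :* (x :* z)) refl x (x ⁻¹) y)
    (trans (*-congˡ xy≈0) (zeroʳ _))))

  ≉0-* : ∀ {x y} → x ≉ 0# → y ≉ 0# → x * y ≉ 0#
  ≉0-* x≉0 y≉0 xy≈0 = y≉0 (*-cancel-≉0 x≉0 xy≈0)

  0<* : ∀ {x y} → 0# < x → 0# < y → 0# < x * y
  0<* 0<x 0<y = 0≤* (<⇒≤ 0<x) (<⇒≤ 0<y) ,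
    λ 0≈xy → ≉0-* (0<⇒≉0 0<x) (0<⇒≉0 0<y) (sym 0≈xy)

  0<+ : ∀ {x y} → 0# < x → 0# ≤ y → 0# < x + y
  0<+ {x} {y} 0<x 0≤y = <-≤-trans 0<x (≤-by 0≤y (solve 2 (λ x y → x :+ y :- x := y) refl x y))

  0<2 : 0# < 2#
  0<2 = 0<+ 0<1 0≤1

  *-cancel-≤ : ∀ {c x y} → 0# < c → c * x ≤ c * y → x ≤ y
  *-cancel-≤ {c} {x} {y} 0<c cx≤cy = ≮⇒≥ λ y<x →
    <⇒≱ (0<* 0<c (<⇒0<- y<x)) (≤-by (≤⇒0≤- cx≤cy)
            (solve 3 (λ x y z → con (+ 0) :- x :* (y :- z) := x :* z :- x :* y) refl c x y))

  ⁻¹-cancelˡ : ∀ {x} y → x ≉ 0# → x * (x ⁻¹ * y) ≈ y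
  ⁻¹-cancelˡ {x} y x≉0 = trans (sym (*-assoc _ _ _))
    (trans (*-congʳ (⁻¹-inverse x x≉0)) (*-identityˡ y))

  /-cancel : ∀ x {y} → y ≉ 0# → x / y * y ≈ x
  /-cancel x {y} y≉0 = trans (solve 3 (λ x y z → x :* y :* z := z :* (y :* x))
          refl x (y ⁻¹) y) (⁻¹-cancelˡ x y≉0)

  *-cancelˡ : ∀ {c x y} → c ≉ 0# → c * x ≈ c * y → x ≈ y
  *-cancelˡ {c} {x} {y} c≉0 cx≈cy = begin
    x                  ≈⟨ ⁻¹-cancelˡ x c≉0 ⟨
    c * (c ⁻¹ * x)     ≈⟨ (solve 3 (λ x y z → x :* (y :* z) := y :* (x :* z)) refl c (c ⁻¹) x) ⟩
    c ⁻¹ * (c * x)     ≈⟨ *-congˡ cx≈cy ⟩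
    c ⁻¹ * (c * y)     ≈⟨ (solve 3 (λ x y z → x :* (y :* z) := y :* (x :* z)) refl (c ⁻¹) c y) ⟩
    c * (c ⁻¹ * y)     ≈⟨ ⁻¹-cancelˡ y c≉0 ⟩
    y                  ∎
    where open import Relation.Binary.Reasoning.Setoid setoid

  ⁻¹-unique : ∀ {x y} → x * y ≈ 1# → x ⁻¹ ≈ y
  ⁻¹-unique {x} {y} xy≈1 = *-cancelˡ x≉0 (trans (⁻¹-inverse x x≉0) (sym xy≈1))
    where
    x≉0 : x ≉ 0#
    x≉0 x≈0 = 0≉1 (trans (sym (zeroˡ y)) (trans (*-congʳ (sym x≈0)) xy≈1))

  ⁻¹-pos : ∀ {x} → 0# < x → 0# < x ⁻¹
  ⁻¹-pos {x} 0<x = ≰⇒> λ x⁻¹≤0 → <⇒≱ 0<1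
    (≤-by (0≤+ (≤⇒0≤- (≈⇒≥ (⁻¹-inverse x (0<⇒≉0 0<x)))) (0≤* (<⇒≤ 0<x) (≤⇒0≤- x⁻¹≤0)))
            (solve 2 (λ x y → con (+ 0) :- con (+ 1) := x :* y :- con (+ 1) :+ x :* (con (+ 0)
            :- y)) refl x (x ⁻¹)))

  0</ : ∀ {x y} → 0# < x → 0# < y → 0# < x / y
  0</ 0<x 0<y = 0<* 0<x (⁻¹-pos 0<y)

  half : ℝ → ℝ
  half x = x / 2#

  half+half : ∀ x → half x + half x ≈ x
  half+half x = trans (solve 2 (λ x y → x :* y :+ x :* y := x :* y :* con (+ 2))
          refl x (2# ⁻¹)) (/-cancel x (0<⇒≉0 0<2))

  0<half : ∀ {x} → 0# < x → 0# < half x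
  0<half 0<x = 0</ 0<x 0<2

  common-upper : ∀ x y → ∃[ z ] (x ≤ z × y ≤ z)
  common-upper x y with total x y
  ... | inj₁ x≤y = y , x≤y , ≤-refl
  ... | inj₂ y≤x = x , ≤-refl , y≤x

  common-lower : ∀ {x y} → 0# < x → 0# < y → ∃[ z ] (0# < z × z ≤ x × z ≤ y)
  common-lower {x} {y} 0<x 0<y with total x y
  ... | inj₁ x≤y = x , 0<x , ≤-refl , x≤y
  ... | inj₂ y≤x = y , 0<y , y≤x , ≤-refl

  -- `total` is an abstract field, so `∣ x ∣` does not reduce; generalising over its result is what
  -- gives access to the two cases.
  ∣∣-elim : (P : ℝ → Set) → ∀ x → (0# ≤ x → P x) → (x ≤ 0# → P (- x)) → P ∣ x ∣
  ∣∣-elim P x pos neg = go (total 0# x)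
    where
    go : (t : 0# ≤ x ⊎ x ≤ 0#) → P ([ (λ _ → x) , (λ _ → - x) ]′ t)
    go (inj₁ 0≤x) = pos 0≤x
    go (inj₂ x≤0) = neg x≤0

  x≤∣x∣ : ∀ x → x ≤ ∣ x ∣
  x≤∣x∣ x = ∣∣-elim (x ≤_) x (λ _ → ≤-refl) λ x≤0 →
    (≤-by (0≤+ (≤⇒0≤- x≤0) (≤⇒0≤- x≤0)) (solve 1 (λ x → :- x :- x := con (+ 0) :- x :+ (con (+ 0)
            :- x)) refl x))

  -x≤∣x∣ : ∀ x → - x ≤ ∣ x ∣
  -x≤∣x∣ x = ∣∣-elim (- x ≤_) x (λ 0≤x → (≤-by (0≤+ 0≤x 0≤x)
          (solve 1 (λ x → x :- :- x := x :+ x) refl x))) λ _ → ≤-refl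

  ∣∣-least : ∀ {x b} → x ≤ b → - x ≤ b → ∣ x ∣ ≤ b
  ∣∣-least {x} {b} x≤b -x≤b = ∣∣-elim (_≤ b) x (λ _ → x≤b) (λ _ → -x≤b)

  0≤∣x∣ : ∀ x → 0# ≤ ∣ x ∣
  0≤∣x∣ x = ∣∣-elim (0# ≤_) x (λ 0≤x → 0≤x) λ x≤0 → (0≤-by (≤⇒0≤- x≤0)
          (solve 1 (λ x → :- x := con (+ 0) :- x) refl x))

  ∣∣-mono : ∀ {x y} → x ≈ y → ∣ x ∣ ≤ ∣ y ∣
  ∣∣-mono x≈y = ∣∣-least (≤-respˡ-≈ (sym x≈y) (x≤∣x∣ _)) (≤-respˡ-≈ (-‿cong (sym x≈y)) (-x≤∣x∣ _))

  ∣∣-cong : ∀ {x y} → x ≈ y → ∣ x ∣ ≈ ∣ y ∣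
  ∣∣-cong x≈y = antisym (∣∣-mono x≈y) (∣∣-mono (sym x≈y))

  0≤x⇒∣x∣≈x : ∀ {x} → 0# ≤ x → ∣ x ∣ ≈ x
  0≤x⇒∣x∣≈x {x} 0≤x = antisym (∣∣-least ≤-refl (≤-by (0≤+ 0≤x 0≤x)
          (solve 1 (λ x → x :- :- x := x :+ x) refl x))) (x≤∣x∣ x)

  x≤0⇒∣x∣≈-x : ∀ {x} → x ≤ 0# → ∣ x ∣ ≈ - x
  x≤0⇒∣x∣≈-x {x} x≤0 = antisym (∣∣-least (≤-by (0≤+ (≤⇒0≤- x≤0) (≤⇒0≤- x≤0))
          (solve 1 (λ x → :- x :- x := con (+ 0) :- x :+ (con (+ 0) :- x))
          refl x)) ≤-refl) (-x≤∣x∣ x)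

  ∣-x∣≈∣x∣ : ∀ x → ∣ - x ∣ ≈ ∣ x ∣
  ∣-x∣≈∣x∣ x = antisym
    (∣∣-least (-x≤∣x∣ x) (≤-respˡ-≈ (solve 1 (λ x → x := :- (:- x)) refl x) (x≤∣x∣ x)))
    (∣∣-least (≤-respˡ-≈ (solve 1 (λ x → :- (:- x) := x) refl x) (-x≤∣x∣ (- x))) (x≤∣x∣ (- x)))

  ∣x+y∣≤∣x∣+∣y∣ : ∀ x y → ∣ x + y ∣ ≤ ∣ x ∣ + ∣ y ∣
  ∣x+y∣≤∣x∣+∣y∣ x y = ∣∣-least
    (≤-by (0≤+ (≤⇒0≤- (x≤∣x∣ x)) (≤⇒0≤- (x≤∣x∣ y)))
            (solve 4 (λ x y z u → x :+ y :- (z :+ u) := x :- z :+ (y :- u))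
            refl (∣ x ∣) (∣ y ∣) x y))
    (≤-by (0≤+ (≤⇒0≤- (-x≤∣x∣ x)) (≤⇒0≤- (-x≤∣x∣ y)))
            (solve 4 (λ x y z u → x :+ y :- :- (z :+ u) := x :- :- z :+ (y :- :- u))
            refl (∣ x ∣) (∣ y ∣) x y))

  ∣x-y∣≤∣x∣+∣y∣ : ∀ x y → ∣ x - y ∣ ≤ ∣ x ∣ + ∣ y ∣
  ∣x-y∣≤∣x∣+∣y∣ x y = ≤-trans (∣x+y∣≤∣x∣+∣y∣ x (- y)) (≈⇒≤ (+-congˡ (∣-x∣≈∣x∣ y)))

  ∣x*y∣≈∣x∣*∣y∣ : ∀ x y → ∣ x * y ∣ ≈ ∣ x ∣ * ∣ y ∣
  ∣x*y∣≈∣x∣*∣y∣ x y with total 0# x | total 0# y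
  ... | inj₁ 0≤x | inj₁ 0≤y = 0≤x⇒∣x∣≈x (0≤* 0≤x 0≤y)
  ... | inj₁ 0≤x | inj₂ y≤0 = trans
    (x≤0⇒∣x∣≈-x (≤-by (0≤* 0≤x (≤⇒0≤- y≤0))
            (solve 2 (λ x y → con (+ 0) :- x :* y := x :* (con (+ 0) :- y)) refl x y)))
    (solve 2 (λ x y → :- (x :* y) := x :* :- y) refl x y)
  ... | inj₂ x≤0 | inj₁ 0≤y = trans
    (x≤0⇒∣x∣≈-x (≤-by (0≤* 0≤y (≤⇒0≤- x≤0))
            (solve 2 (λ x y → con (+ 0) :- x :* y := y :* (con (+ 0) :- x)) refl x y)))
    (solve 2 (λ x y → :- (x :* y) := :- x :* y) refl x y)
  ... | inj₂ x≤0 | inj₂ y≤0 = trans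
    (0≤x⇒∣x∣≈x (0≤-by (0≤* (≤⇒0≤- x≤0) (≤⇒0≤- y≤0))
            (solve 2 (λ x y → x :* y := (con (+ 0) :- x) :* (con (+ 0) :- y)) refl x y)))
    (solve 2 (λ x y → x :* y := :- x :* :- y) refl x y)

  *-mono-≤ : ∀ {x y u v} → 0# ≤ x → 0# ≤ u → x ≤ y → u ≤ v → x * u ≤ y * v
  *-mono-≤ {x} {y} {u} {v} 0≤x 0≤u x≤y u≤v =
    (≤-by (0≤+ (0≤+ (0≤* (≤⇒0≤- x≤y) 0≤u) (0≤* (≤⇒0≤- x≤y) (≤⇒0≤- u≤v))) (0≤* 0≤x (≤⇒0≤- u≤v)))
            (solve 4 (λ x y z u → x :* y :- z :* u := (x :- z) :* u :+ (x :- z) :* (y :- u) :+ z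
            :* (y :- u)) refl y v x u))

  +-mono-≤ : ∀ {x y u v} → x ≤ y → u ≤ v → x + u ≤ y + v
  +-mono-≤ {x} {y} {u} {v} x≤y u≤v = (≤-by (0≤+ (≤⇒0≤- x≤y) (≤⇒0≤- u≤v))
          (solve 4 (λ x y z u → x :+ y :- (z :+ u) := x :- z :+ (y :- u)) refl y v x u))

  ∣x*y∣≤ : ∀ {x y a b} → ∣ x ∣ ≤ a → ∣ y ∣ ≤ b → ∣ x * y ∣ ≤ a * b
  ∣x*y∣≤ {x} {y} p q = ≤-respˡ-≈ (sym (∣x*y∣≈∣x∣*∣y∣ x y)) (*-mono-≤ (0≤∣x∣ x) (0≤∣x∣ y) p q)

  ∣x+y∣≤ : ∀ {x y a b} → ∣ x ∣ ≤ a → ∣ y ∣ ≤ b → ∣ x + y ∣ ≤ a + b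
  ∣x+y∣≤ {x} {y} p q = ≤-trans (∣x+y∣≤∣x∣+∣y∣ x y) (+-mono-≤ p q)

  ∣x-y∣≈∣y-x∣ : ∀ x y → ∣ x - y ∣ ≈ ∣ y - x ∣
  ∣x-y∣≈∣y-x∣ x y = trans (sym (∣-x∣≈∣x∣ (x - y))) (∣∣-cong
          (solve 2 (λ x y → :- (x :- y) := y :- x) refl x y))

  ∣⁻¹∣ : ∀ {x} → x ≉ 0# → ∣ x ⁻¹ ∣ * ∣ x ∣ ≈ 1#
  ∣⁻¹∣ {x} x≉0 = trans (sym (∣x*y∣≈∣x∣*∣y∣ (x ⁻¹) x))
    (trans (∣∣-cong (trans (*-comm (x ⁻¹) x) (⁻¹-inverse x x≉0))) (0≤x⇒∣x∣≈x 0≤1))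

  0≤fromℕ : ∀ n → 0# ≤ fromℕ n
  0≤fromℕ zero    = ≤-refl
  0≤fromℕ (suc n) = 0≤+ 0≤1 (0≤fromℕ n)

  0<fromℕ-suc : ∀ n → 0# < fromℕ (suc n)
  0<fromℕ-suc n = 0<+ 0<1 (0≤fromℕ n)

  0<fromℕ : ∀ {n} → 1 ℕ.≤ n → 0# < fromℕ n
  0<fromℕ {suc n} _ = 0<fromℕ-suc n

  fromℕ-mono : ∀ {m n} → m ℕ.≤ n → fromℕ m ≤ fromℕ n
  fromℕ-mono {n = n} ℕ.z≤n = 0≤fromℕ n
  fromℕ-mono (ℕ.s≤s m≤n)   = +-mono-≤ ≤-refl (fromℕ-mono m≤n)

  -- Otherwise `x` bounds all naturals and they have a supremum `s`. From n + 1 ≤ s for every n,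
  -- `s - 1#` is an upper bound too, which is absurd.
  archimedean : ∀ x → ∃[ n ] (x ≤ fromℕ n)
  archimedean x with em {∃[ n ] (x ≤ fromℕ n)}
  ... | yes found = found
  ... | no  none  = contradiction s≤s-1 (<⇒≱ (0<-⇒< (<-≤-trans 0<1 (≈⇒≥
          (solve 1 (λ x → x :- (x :- con (+ 1)) := con (+ 1)) refl s)))))
    where
    IsNatural : ℝ → Set
    IsNatural y = ∃[ n ] y ≈ fromℕ n

    bound : UpperBound IsNatural x
    bound y (n , y≈n) = ≤-respˡ-≈ (sym y≈n) (<⇒≤ (≰⇒> λ x≤n → none (n , x≤n)))

    lub = supremum IsNatural (0# , 0 , refl) (x , bound)
    s = proj₁ lub

    s≤s-1 : s ≤ s - 1#
    s≤s-1 = proj₂ (proj₂ lub) (s - 1#) λ y (n , y≈n) →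
      (≤-by (0≤+ (≤⇒0≤- (≈⇒≤ y≈n)) (≤⇒0≤- (proj₁ (proj₂ lub) (fromℕ (suc n)) (suc n , refl))))
              (solve 3 (λ x y z → x :- con (+ 1) :- y := z :- y :+ (x :- (con (+ 1) :+ z)))
              refl s y (fromℕ n)))

  Eventually-map : ∀ {P Q : ℕ → Set} → (∀ n → P n → Q n) → Eventually P → Eventually Q
  Eventually-map f (N , p) = N , λ n N≤n → f n (p n N≤n)

  Eventually-∧ : ∀ {P Q : ℕ → Set} → Eventually P → Eventually Q → Eventually (λ n → P n × Q n)
  Eventually-∧ (M , p) (N , q) = M ℕ.⊔ N , λ n M⊔N≤n →
    p n (ℕ.≤-trans (ℕ.m≤m⊔n M N) M⊔N≤n) , q n (ℕ.≤-trans (ℕ.m≤n⊔m M N) M⊔N≤n)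

  Eventually-map₂ : ∀ {P Q S : ℕ → Set} → (∀ n → P n → Q n → S n) →
                    Eventually P → Eventually Q → Eventually S
  Eventually-map₂ f p q = Eventually-map (λ n (x , y) → f n x y) (Eventually-∧ p q)

  Eventually-suc : ∀ {P : ℕ → Set} → Eventually P → Eventually (λ n → P (suc n))
  Eventually-suc (N , p) = N , λ n N≤n → p (suc n) (ℕ.m≤n⇒m≤1+n N≤n)

  fromℕ-unbounded : ∀ x → Eventually (λ n → x ≤ fromℕ n)
  fromℕ-unbounded x with archimedean x
  ... | N , x≤N = N , λ n N≤n → ≤-trans x≤N (fromℕ-mono N≤n)

  positive : Eventually (λ n → 1 ℕ.≤ n)
  positive = 1 , λ _ 1≤n → 1≤n

-- The exponential function from Euler's limit

module Exponential (em : ExcludedMiddle 0ℓ) (R : RealNumbers) (E : RealNumbers.ExpLog R) where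

  open RealNumbers R
  open ExpLog E
  open OrderedField em R
  open Algebra.Properties.CommutativeSemiring.Exp commutativeSemiring using (^-congˡ; ^-distrib-*)
  open Relation.Binary.Reasoning.Setoid setoid

  ≈-by-small : ∀ {x y} → (∀ ε → 0# < ε → ∣ x - y ∣ ≤ ε + ε + ε) → x ≈ y
  ≈-by-small {x} {y} small = antisym
    (≤-small x y small)
    (≤-small y x λ ε 0<ε → ≤-respˡ-≈ (∣x-y∣≈∣y-x∣ x y) (small ε 0<ε))
    where
    ≤-small : ∀ x y → (∀ ε → 0# < ε → ∣ x - y ∣ ≤ ε + ε + ε) → x ≤ y
    ≤-small x y small = ≮⇒≥ λ y<x →
      let d   = x - y
          -- A quarter of `d`: the assumption would give d ≤ 3 d / 4.
          ε   = half (half d)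
          0<ε = 0<half (0<half (<⇒0<- y<x))
      in <⇒≱ 0<ε (≤-by (0≤+ (0≤+ (0≤+ (0≤+ (≤⇒0≤- (x≤∣x∣ (x - y))) (≤⇒0≤- (small ε 0<ε)))
              (≤⇒0≤- (≈⇒≤ (half+half (half d))))) (≤⇒0≤- (≈⇒≤ (half+half (half d)))))
              (≤⇒0≤- (≈⇒≤ (half+half d))))
              (solve 5 (λ x y z u v → con (+ 0) :- x := y :- (z :- u) :+ (x :+ x :+ x :- y) :+ (v
              :- (x :+ x)) :+ (v :- (x :+ x)) :+ (z :- u :- (v :+ v)))
              refl ε (∣ x - y ∣) x y (half d)))

  infix 4 _⇝_
  _⇝_ : (ℕ → ℝ) → ℝ → Set
  s ⇝ l = ∀ ε → 0# < ε → Eventually (λ n → ∣ s n - l ∣ ≤ ε)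

  ⟶⇒⇝ : ∀ {s l} → s ⟶ l → s ⇝ l
  ⟶⇒⇝ s⟶l ε 0<ε = Eventually-map (λ _ → <⇒≤) (s⟶l ε 0<ε)

  Eventually-witness : ∀ {P : ℕ → Set} → Eventually P → ∃ P
  Eventually-witness (N , p) = N , p N ℕ.≤-refl

  ⇝-unique : ∀ {s t l m} → s ⇝ l → t ⇝ m → (λ n → s n - t n) ⇝ 0# → l ≈ m
  ⇝-unique {s} {t} {l} {m} s⇝l t⇝m s-t⇝0 = ≈-by-small λ ε 0<ε →
    let n , (p , q) , r = Eventually-witness
          (Eventually-∧ (Eventually-∧ (s⇝l ε 0<ε) (t⇝m ε 0<ε)) (s-t⇝0 ε 0<ε))
    in ≤-respˡ-≈
         (∣∣-cong (solve 4 (λ x y z u → :- (x :- y) :+ (z :- u) :+ (x :- z :- con (+ 0)) := y :- u)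
                 refl (s n) l (t n) m))
         (∣x+y∣≤ (∣x+y∣≤ (≤-respˡ-≈ (sym (∣-x∣≈∣x∣ _)) p) q) r)

  ⇝-lower : ∀ {s l c} → s ⇝ l → Eventually (λ n → c ≤ s n) → c ≤ l
  ⇝-lower {s} {l} {c} s⇝l c≤s = ≮⇒≥ λ l<c →
    let d   = c - l
        0<ε = 0<half (<⇒0<- l<c)
        n , p , q = Eventually-witness (Eventually-∧ (s⇝l (half d) 0<ε) c≤s)
    in <⇒≱ 0<ε (≤-by (0≤+ (0≤+ (≤⇒0≤- (≤-trans (x≤∣x∣ _) p)) (≤⇒0≤- q)) (≤⇒0≤- (≈⇒≤ (half+half d))))
            (solve 4 (λ x y z u → con (+ 0) :- x := x :- (y :- z) :+ (y :- u) :+ (u :- z :- (x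
            :+ x))) refl (half d) (s n) l c))

  ⇝-bounded : ∀ {s l} → s ⇝ l → Eventually (λ n → s n ≤ l + 1#)
  ⇝-bounded {s} {l} s⇝l = Eventually-map
    (λ n p → (≤-by (≤⇒0≤- (≤-trans (x≤∣x∣ _) p))
            (solve 2 (λ x y → x :+ con (+ 1) :- y := con (+ 1) :- (y :- x))
            refl l (s n)))) (s⇝l 1# 0<1)

  ⇝-* : ∀ {s t l m} → s ⇝ l → t ⇝ m → (λ n → s n * t n) ⇝ l * m
  ⇝-* {s} {t} {l} {m} s⇝l t⇝m ε 0<ε =
    -- When both factors are off by at most δ ≤ 1, the product is off by at most δ (∣ l ∣ + ∣ m ∣ +
    -- 1) = δ `K`.
    let K = ∣ l ∣ + ∣ m ∣ + 1#
        0<K = ≤-<-trans (0≤+ (0≤∣x∣ l) (0≤∣x∣ m))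
          (0<-⇒< (<-≤-trans 0<1 (≈⇒≥ (solve 2 (λ x y → x :+ y :+ con (+ 1) :- (x :+ y) := con (+ 1))
                  refl (∣ l ∣) (∣ m ∣)))))
        δ , 0<δ , δ≤1 , δ≤ε/K = common-lower 0<1 (0</ 0<ε 0<K)
    in Eventually-map₂
      (λ n p q → ≤-trans
        (≤-respˡ-≈
          (∣∣-cong (solve 4 (λ x y z u → (x :- y) :* (z :- u) :+ (y :* (z :- u) :+ (x :- y) :* u)
                  := x :* z :- y :* u) refl (s n) l (t n) m))
          (∣x+y∣≤ (∣x*y∣≤ p (≤-trans q δ≤1)) (∣x+y∣≤ (∣x*y∣≤ ≤-refl q) (∣x*y∣≤ p ≤-refl))))
        (≤-respˡ-≈ (solve 3 (λ x y z → x :* (y :+ z :+ con (+ 1)) := x :* con (+ 1) :+ (y :* x :+ x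
                :* z)) refl δ (∣ l ∣) (∣ m ∣))
          (≤-trans (*-mono-≤ (<⇒≤ 0<δ) (<⇒≤ 0<K) δ≤ε/K ≤-refl)
            (≈⇒≤ (/-cancel ε (0<⇒≉0 0<K))))))
      (s⇝l δ 0<δ) (t⇝m δ 0<δ)

  ∣x^n∣≤ : ∀ {x M} n → ∣ x ∣ ≤ M → ∣ x ^ n ∣ ≤ M ^ n
  ∣x^n∣≤ zero    _ = ≈⇒≤ (0≤x⇒∣x∣≈x 0≤1)
  ∣x^n∣≤ (suc n) p = ∣x*y∣≤ p (∣x^n∣≤ n p)

  -- Telescoping: each of the n replacements of a factor x by y costs one ∣ x - y ∣. The sharp power
  -- of M is n - 1; since 1 ≤ M it may be raised to n, which avoids truncated subtraction.
  ∣x^n-y^n∣≤ : ∀ {x y M} n → 1# ≤ M → ∣ x ∣ ≤ M → ∣ y ∣ ≤ M →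
               ∣ x ^ n - y ^ n ∣ ≤ fromℕ n * ∣ x - y ∣ * M ^ n
  ∣x^n-y^n∣≤ zero _ _ _ = ≈⇒≤ (trans (∣∣-cong (-‿inverseʳ 1#)) (trans (0≤x⇒∣x∣≈x ≤-refl)
    (sym (trans (*-congʳ (zeroˡ _)) (zeroˡ _)))))
  ∣x^n-y^n∣≤ {x} {y} {M} (suc n) 1≤M ∣x∣≤M ∣y∣≤M = ≤-trans
    (≤-respˡ-≈
      (∣∣-cong (solve 4 (λ x y z u → x :* (y :- z) :+ (x :- u) :* z := x :* y :- u :* z)
              refl x (x ^ n) (y ^ n) y))
      (∣x+y∣≤ (∣x*y∣≤ ∣x∣≤M (∣x^n-y^n∣≤ n 1≤M ∣x∣≤M ∣y∣≤M)) (∣x*y∣≤ ≤-refl (∣x^n∣≤ n ∣y∣≤M))))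
    (≤-by (0≤* (0≤* (≤⇒0≤- 1≤M) (0≤∣x∣ (x - y))) (≤-trans (0≤∣x∣ (y ^ n)) (∣x^n∣≤ n ∣y∣≤M)))
            (solve 4 (λ x y z u → (con (+ 1) :+ x) :* y :* (z :* u) :- (z :* (x :* y :* u) :+ y
            :* u) := (z :- con (+ 1)) :* y :* u) refl (fromℕ n) (∣ x - y ∣) M (M ^ n)))

  bernoulli : ∀ {y} n → 0# ≤ 1# + y → 1# + fromℕ n * y ≤ (1# + y) ^ n
  bernoulli {y} zero    _     = (≤-by ≤-refl
          (solve 1 (λ x → con (+ 1) :- (con (+ 1) :+ con (+ 0) :* x) := con (+ 0)) refl y))
  bernoulli {y} (suc n) 0≤1+y =
    (≤-by (0≤+ (0≤* 0≤1+y (≤⇒0≤- (bernoulli n 0≤1+y))) (0≤* (0≤fromℕ n) (0≤x*x y)))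
            (solve 3 (λ x y z → (con (+ 1) :+ x) :* y :- (con (+ 1) :+ (con (+ 1) :+ z) :* x)
            := (con (+ 1) :+ x) :* (y :- (con (+ 1) :+ z :* x)) :+ z :* (x :* x))
            refl y ((1# + y) ^ n) (fromℕ n)))

  euler : ℝ → ℕ → ℝ
  euler x n = (1# + x / fromℕ n) ^ n

  euler⇝exp : ∀ x → euler x ⇝ exp x
  euler⇝exp x = ⟶⇒⇝ (exp-limit x)

  -- `exp` is a bare function on a setoid, so its congruence has to be recovered from the uniqueness
  -- of limits.
  exp-cong : ∀ {x y} → x ≈ y → exp x ≈ exp y
  exp-cong {x} {y} x≈y = ⇝-unique (euler⇝exp x) (euler⇝exp y) λ ε 0<ε →
    0 , λ n _ → ≤-respˡ-≈ (sym (trans (∣∣-cong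
      (trans (+-congʳ (trans (+-congʳ (^-congˡ n (+-congˡ (*-congʳ x≈y)))) (-‿inverseʳ _)))
             (-‿inverseʳ 0#)))
      (0≤x⇒∣x∣≈x ≤-refl))) (<⇒≤ 0<ε)

  -- Bernoulli's inequality for x / n, applicable as soon as n ≥ - x, passes to the limit.
  1+x≤exp : ∀ x → 1# + x ≤ exp x
  1+x≤exp x = ⇝-lower (euler⇝exp x) (Eventually-map₂
    (λ n 1≤n -x≤n →
      let 0<n = 0<fromℕ 1≤n
          n*x/n≈x = trans (*-comm _ _) (/-cancel x (0<⇒≉0 0<n))
      in ≤-respˡ-≈ (+-congˡ n*x/n≈x)
           (bernoulli n (*-cancel-≤ 0<n
             (≤-by (0≤+ (≤⇒0≤- -x≤n) (≤⇒0≤- (≈⇒≥ n*x/n≈x)))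
                     (solve 3 (λ x y z → x :* (con (+ 1) :+ y) :- x :* con (+ 0) := x :- :- z :+ (x
                     :* y :- z)) refl (fromℕ n) (x / fromℕ n) x)))))
    positive (fromℕ-unbounded (- x)))

  -- The bases satisfy (1 + x/n) (1 + y/n) - (1 + (x + y)/n) = x y / n². Taking nth powers magnifies
  -- this by at most n `M ^ n`, where `M ^ n` stays bounded, so the two Euler sequences differ by
  -- O(1/n).
  exp-+ : ∀ x y → exp (x + y) ≈ exp x * exp y
  exp-+ x y = sym (⇝-unique (⇝-* (euler⇝exp x) (euler⇝exp y)) (euler⇝exp (x + y)) close)
    where
    -- The limit of `euler (∣ x ∣) n * euler (∣ y ∣) n`, which is `M ^ n` below, increased by 1 to
    -- become an eventual bound.
    K = exp (∣ x ∣) * exp (∣ y ∣) + 1#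
    xy = ∣ x * y ∣

    1≤1+∣z∣/ : ∀ z {n} → 1 ℕ.≤ n → 1# ≤ 1# + ∣ z ∣ / fromℕ n
    1≤1+∣z∣/ z {n} 1≤n = (≤-by (0≤* (0≤∣x∣ z) (<⇒≤ (⁻¹-pos (0<fromℕ 1≤n))))
            (solve 1 (λ x → con (+ 1) :+ x :- con (+ 1) := x) refl (∣ z ∣ / fromℕ n)))

    ∣1+z/∣≤ : ∀ z {n} → 1 ℕ.≤ n → ∣ 1# + z / fromℕ n ∣ ≤ 1# + ∣ z ∣ / fromℕ n
    ∣1+z/∣≤ z {n} 1≤n = ∣x+y∣≤ (≈⇒≤ (0≤x⇒∣x∣≈x 0≤1))
      (∣x*y∣≤ ≤-refl (≈⇒≤ (0≤x⇒∣x∣≈x (<⇒≤ (⁻¹-pos (0<fromℕ 1≤n))))))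

    close : (λ n → euler x n * euler y n - euler (x + y) n) ⇝ 0#
    close ε 0<ε = Eventually-map₂ estimate
      (Eventually-∧ positive (⇝-bounded (⇝-* (euler⇝exp (∣ x ∣)) (euler⇝exp (∣ y ∣)))))
      (fromℕ-unbounded (xy * K / ε))
      where
      estimate : ∀ n → (1 ℕ.≤ n × euler (∣ x ∣) n * euler (∣ y ∣) n ≤ K) → xy * K / ε ≤ fromℕ n →
                 ∣ euler x n * euler y n - euler (x + y) n - 0# ∣ ≤ ε
      estimate n (1≤n , M≤K) n-large = ≤-respˡ-≈
        (∣∣-cong (trans (+-congʳ (^-distrib-* (1# + x / N) (1# + y / N) n))
          (solve 3 (λ x y z → x :* y :- z := x :* y :- z :- con (+ 0))
                  refl (euler x n) (euler y n) (euler (x + y) n))))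
        (≤-trans (∣x^n-y^n∣≤ {M = M} n 1≤M
          (∣x*y∣≤ (∣1+z/∣≤ x 1≤n) (∣1+z/∣≤ y 1≤n))
          (≤-trans (∣1+z/∣≤ (x + y) 1≤n) M-bound))
        (≤-trans (*-mono-≤ (0≤* (0≤fromℕ n) (0≤∣x∣ _)) 0≤M^n ≤-refl
            (≤-respˡ-≈ (sym (^-distrib-* _ _ n)) M≤K))
          (*-cancel-≤ 0<N (≤-respˡ-≈ (sym lhs) (≤-trans xyK≤εN (≈⇒≤ (*-comm ε N)))))))
        where
        N = fromℕ n
        0<N = 0<fromℕ 1≤n
        M = (1# + (∣ x ∣) / N) * (1# + (∣ y ∣) / N)
        A = (1# + x / N) * (1# + y / N)
        B = 1# + (x + y) / N

        1≤M : 1# ≤ M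
        1≤M = ≤-respˡ-≈ (*-identityˡ 1#) (*-mono-≤ 0≤1 0≤1 (1≤1+∣z∣/ x 1≤n) (1≤1+∣z∣/ y 1≤n))

        0≤M^n : 0# ≤ M ^ n
        0≤M^n = ≤-trans (0≤∣x∣ (1# ^ n)) (∣x^n∣≤ n (≤-respˡ-≈ (sym (0≤x⇒∣x∣≈x 0≤1)) 1≤M))

        0≤N⁻¹ : 0# ≤ N ⁻¹
        0≤N⁻¹ = <⇒≤ (⁻¹-pos 0<N)

        M-bound : 1# + ∣ x + y ∣ / N ≤ M
        M-bound = (≤-by (0≤+ (0≤* (≤⇒0≤- (∣x+y∣≤∣x∣+∣y∣ x y)) 0≤N⁻¹) (0≤* (0≤* (0≤∣x∣ x) 0≤N⁻¹) (0≤*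
                (0≤∣x∣ y) 0≤N⁻¹)))
                (solve 4 (λ x y z u → (con (+ 1) :+ x :* y) :* (con (+ 1) :+ z :* y) :- (con (+ 1)
                :+ u :* y) := (x :+ z :- u) :* y :+ x :* y :* (z :* y))
                refl (∣ x ∣) (N ⁻¹) (∣ y ∣) (∣ x + y ∣)))

        N*N⁻¹≈1 : N * N ⁻¹ ≈ 1#
        N*N⁻¹≈1 = ⁻¹-inverse N (0<⇒≉0 0<N)

        ∣A-B∣≈ : ∣ A - B ∣ ≈ xy * (N ⁻¹ * N ⁻¹)
        ∣A-B∣≈ = trans
          (∣∣-cong (solve 3 (λ x y z → (con (+ 1) :+ x :* y) :* (con (+ 1) :+ z :* y) :- (con (+ 1)
                  :+ (x :+ z) :* y) := x :* z :* (y :* y)) refl x (N ⁻¹) y))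
          (trans (∣x*y∣≈∣x∣*∣y∣ _ _) (*-congˡ (0≤x⇒∣x∣≈x (0≤* 0≤N⁻¹ 0≤N⁻¹))))

        lhs : N * (N * ∣ A - B ∣ * K) ≈ xy * K
        lhs = begin
          N * (N * ∣ A - B ∣ * K)                  ≈⟨ *-congˡ (*-congʳ (*-congˡ ∣A-B∣≈)) ⟩
          N * (N * (xy * (N ⁻¹ * N ⁻¹)) * K)       ≈⟨
                  (solve 4 (λ x y z u → x :* (x :* (y :* (z :* z)) :* u) := x :* z :* (x :* z) :* (y
                  :* u)) refl N xy (N ⁻¹) K) ⟩
          (N * N ⁻¹) * (N * N ⁻¹) * (xy * K)       ≈⟨ *-congʳ (*-cong N*N⁻¹≈1 N*N⁻¹≈1) ⟩
          1# * 1# * (xy * K)                       ≈⟨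
                  (solve 2 (λ x y → con (+ 1) :* con (+ 1) :* (x :* y) := x :* y) refl xy K) ⟩
          xy * K                                   ∎

        xyK≤εN : xy * K ≤ ε * N
        xyK≤εN = (≤-by (0≤+ (≤⇒0≤- (≈⇒≥ (/-cancel (xy * K) (0<⇒≉0 0<ε)))) (0≤* (<⇒≤ 0<ε)
                (≤⇒0≤- n-large))) (solve 5 (λ x y z u v → x :* y :- z :* u := v :* x :- z :* u :+ x
                :* (y :- v)) refl ε N xy K (xy * K / ε)))

  exp0≈1 : exp 0# ≈ 1#
  exp0≈1 = *-cancelˡ exp0≉0 (trans (trans (sym (exp-+ 0# 0#)) (exp-cong (+-identityˡ 0#))) (sym (*-identityʳ _)))
    where
    exp0≉0 : exp 0# ≉ 0#
    exp0≉0 = 0<⇒≉0 (<-≤-trans 0<1 (≤-respˡ-≈ (+-identityʳ 1#) (1+x≤exp 0#)))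

  exp*exp-neg : ∀ x → exp x * exp (- x) ≈ 1#
  exp*exp-neg x = trans (sym (exp-+ x (- x))) (trans (exp-cong (-‿inverseʳ x)) exp0≈1)

  -- A square, of the exponential of x / 2, and invertible. The bound by 1 + x says nothing for x ≤
  -- -1.
  0<exp : ∀ x → 0# < exp x
  0<exp x = ≤-respʳ-≈ (trans (sym (exp-+ _ _)) (exp-cong (half+half x))) (0≤x*x (exp (half x))) ,
    λ 0≈e → 0≉1 (trans (sym (zeroˡ _)) (trans (*-congʳ 0≈e) (exp*exp-neg x)))

  0≤exp : ∀ x → 0# ≤ exp x
  0≤exp x = <⇒≤ (0<exp x)

  -- The graph lies above its tangent at `x`. Monotonicity and the estimates for steps of the
  -- logarithm are instances.
  exp-strict : ∀ x y → exp x * (1# + (y - x)) ≤ exp y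
  exp-strict x y = ≤-respʳ-≈ (trans (sym (exp-+ x (y - x))) (exp-cong
          (solve 2 (λ x y → x :+ (y :- x) := y) refl x y)))
    (≤-by (0≤* (0≤exp x) (≤⇒0≤- (1+x≤exp (y - x))))
            (solve 4 (λ x y z u → x :* y :- x :* (con (+ 1) :+ (z :- u)) := x :* (y :- (con (+ 1)
            :+ (z :- u)))) refl (exp x) (exp (y - x)) y x))

  exp-mono : ∀ {x y} → x ≤ y → exp x ≤ exp y
  exp-mono {x} {y} x≤y = ≤-trans
    (≤-by (0≤* (0≤exp x) (≤⇒0≤- x≤y)) (solve 3 (λ x y z → x :* (con (+ 1) :+ (y :- z)) :- x := x
            :* (y :- z)) refl (exp x) y x))
    (exp-strict x y)

  exp-cancel-≤ : ∀ {x y} → exp x ≤ exp y → x ≤ y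
  exp-cancel-≤ {x} {y} ex≤ey = ≮⇒≥ λ y<x → <⇒≱ (0<* (0<exp y) (<⇒0<- y<x))
    (≤-by (0≤+ (≤⇒0≤- (exp-strict y x)) (≤⇒0≤- ex≤ey))
            (solve 4 (λ x y z u → con (+ 0) :- x :* (y :- z) := u :- x :* (con (+ 1) :+ (y :- z))
            :+ (x :- u)) refl (exp y) x y (exp x)))

-- Logarithms of naturals, real powers, and growth classes

module Asymptotics (em : ExcludedMiddle 0ℓ) (R : RealNumbers) (E : RealNumbers.ExpLog R) where

  open RealNumbers R
  open ExpLog E
  open OrderedField em R
  open Exponential em R E

  L : ℕ → ℝ
  L n = log (fromℕ n)

  power : ℝ → ℕ → ℝ
  power α n = fromℕ n ^ʳ α

  exp-L : ∀ n → 1 ℕ.≤ n → exp (L n) ≈ fromℕ n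
  exp-L n 1≤n = exp-log _ (0<fromℕ 1≤n)

  -- Write h for the step of the logarithm. The tangent of `exp` at `L n` gives n (1 + h) ≤ n + 1;
  -- the tangent at `L (suc n)` gives the matching lower bound 1/(n + 1) ≤ h.
  L-step-upper : ∀ n → 1 ℕ.≤ n → fromℕ n * (L (suc n) - L n) ≤ 1#
  L-step-upper n 1≤n =
    (≤-by (≤⇒0≤- (≤-respˡ-≈ (*-congʳ (exp-L n 1≤n))
            (≤-respʳ-≈ (exp-L (suc n) (ℕ.s≤s ℕ.z≤n)) (exp-strict (L n) (L (suc n))))))
            (solve 3 (λ x y z → con (+ 1) :- x :* (y :- z) := con (+ 1) :+ x :- x :* (con (+ 1)
            :+ (y :- z))) refl (fromℕ n) (L (suc n)) (L n)))

  L-step-lower : ∀ n → 1 ℕ.≤ n → 1# ≤ (1# + fromℕ n) * (L (suc n) - L n)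
  L-step-lower n 1≤n =
    (≤-by (≤⇒0≤- (≤-respˡ-≈ (*-congʳ (exp-L (suc n) (ℕ.s≤s ℕ.z≤n)))
            (≤-respʳ-≈ (exp-L n 1≤n) (exp-strict (L (suc n)) (L n)))))
            (solve 3 (λ x y z → (con (+ 1) :+ x) :* (y :- z) :- con (+ 1) := x :- (con (+ 1) :+ x)
            :* (con (+ 1) :+ (z :- y))) refl (fromℕ n) (L (suc n)) (L n)))

  L-mono : ∀ n → 1 ℕ.≤ n → L n ≤ L (suc n)
  L-mono n 1≤n = exp-cancel-≤ (≤-respˡ-≈ (sym (exp-L n 1≤n)) (≤-respʳ-≈ (sym (exp-L (suc n) (ℕ.s≤s ℕ.z≤n)))
    (≤-by 0≤1 (solve 1 (λ x → con (+ 1) :+ x :- x := con (+ 1)) refl (fromℕ n)))))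

  L-unbounded : ∀ K → Eventually (λ n → K ≤ L n)
  L-unbounded K = Eventually-map₂
    (λ n 1≤n e≤n → exp-cancel-≤ (≤-respʳ-≈ (sym (exp-L n 1≤n)) e≤n)) positive (fromℕ-unbounded (exp K))

  eventually-log : ∀ {P : ℝ → Set} → EventuallyReal P → Eventually (λ n → P (L n))
  eventually-log (X , p) = Eventually-map (λ n → p (L n)) (L-unbounded X)

  power-+ : ∀ α β n → power (α + β) n ≈ power α n * power β n
  power-+ α β n = trans (exp-cong (distribʳ (L n) α β)) (exp-+ _ _)

  power-cong : ∀ {α β} n → α ≈ β → power α n ≈ power β n
  power-cong n α≈β = exp-cong (*-congʳ α≈β)

  power-mono : ∀ {α β} n → 0# ≤ L n → α ≤ β → power α n ≤ power β n
  power-mono {α} {β} n 0≤L α≤β = exp-mono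
    (≤-by (0≤* (≤⇒0≤- α≤β) 0≤L) (solve 3 (λ x y z → x :* y :- z :* y := (x :- z) :* y)
            refl β (L n) α))

  power-0 : ∀ n → power 0# n ≈ 1#
  power-0 n = trans (exp-cong (zeroˡ _)) exp0≈1

  power-1 : ∀ n → 1 ℕ.≤ n → power 1# n ≈ fromℕ n
  power-1 n 1≤n = trans (exp-cong (*-identityˡ _)) (exp-L n 1≤n)

  power-inverse : ∀ α n → power α n * power (- α) n ≈ 1#
  power-inverse α n = trans (sym (power-+ α (- α) n)) (trans (power-cong n (-‿inverseʳ α)) (power-0 n))

  power-⁻¹ : ∀ α n → power α n ⁻¹ ≈ power (- α) n
  power-⁻¹ α n = ⁻¹-unique (power-inverse α n)

  0<power : ∀ α n → 0# < power α n
  0<power α n = 0<exp _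

  0≤power : ∀ α n → 0# ≤ power α n
  0≤power α n = 0≤exp _

  power-half : ∀ α n → power (half α) n * power (half α) n ≈ power α n
  power-half α n = trans (sym (power-+ _ _ n)) (power-cong n (half+half α))

  ∣power∣ : ∀ α n → ∣ power α n ∣ ≈ power α n
  ∣power∣ α n = 0≤x⇒∣x∣≈x (0≤power α n)

  0≤L : Eventually (λ n → 0# ≤ L n)
  0≤L = L-unbounded 0#

  -- Since n^ε ≥ 1 + ε log n, it suffices that log n ≥ K / ε.
  power-unbounded : ∀ {ε} → 0# < ε → ∀ K → Eventually (λ n → K ≤ power ε n)
  power-unbounded {ε} 0<ε K = Eventually-map
    (λ n K/ε≤L → (≤-by (0≤+ (0≤+ (0≤+ (≤⇒0≤- (1+x≤exp (ε * L n))) (0≤* (<⇒≤ 0<ε) (≤⇒0≤- K/ε≤L)))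
            (≤⇒0≤- (≈⇒≥ (/-cancel K (0<⇒≉0 0<ε))))) 0≤1)
            (solve 5 (λ x y z u v → x :- y := x :- (con (+ 1) :+ z :* u) :+ z :* (u :- v) :+ (v :* z
            :- y) :+ con (+ 1)) refl (power ε n) K ε (L n) (K / ε))))
    (L-unbounded (K / ε))

  -- Growth n^(o(1)). No constant factor is carried, because a slightly smaller ε absorbs it.
  record Subpolynomial (f : ℕ → ℝ) : Set where
    constructor subpolynomial
    field
      bound : ∀ ε → 0# < ε → Eventually (λ n → ∣ f n ∣ ≤ power ε n)

  -- A power saving; here a smaller rate absorbs constants and subpolynomial factors.
  record PowerSmall (f : ℕ → ℝ) : Set where
    constructor powerSmall
    field
      rate   : ℝ
      0<rate : 0# < rate
      bound  : Eventually (λ n → ∣ f n ∣ ≤ power (- rate) n)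

  -- The lower bound is on `f` and not on its absolute value, so eventual positivity is included.
  record NotPowerSmall (f : ℕ → ℝ) : Set where
    constructor notPowerSmall
    field
      bound : ∀ ε → 0# < ε → Eventually (λ n → power (- ε) n ≤ f n)

  sub-cong : ∀ {f g} → Eventually (λ n → f n ≈ g n) → Subpolynomial f → Subpolynomial g
  sub-cong f≈g (subpolynomial b) = subpolynomial λ ε 0<ε →
    Eventually-map₂ (λ n e p → ≤-respˡ-≈ (∣∣-cong e) p) f≈g (b ε 0<ε)

  sub-≤ : ∀ {f g} → Eventually (λ n → ∣ f n ∣ ≤ ∣ g n ∣) → Subpolynomial g → Subpolynomial f
  sub-≤ f≤g (subpolynomial b) = subpolynomial λ ε 0<ε →
    Eventually-map₂ (λ n → ≤-trans) f≤g (b ε 0<ε)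

  sub-const : ∀ c → Subpolynomial (λ _ → c)
  sub-const c = subpolynomial λ ε 0<ε → power-unbounded 0<ε (∣ c ∣)

  sub-+ : ∀ {f g} → Subpolynomial f → Subpolynomial g → Subpolynomial (λ n → f n + g n)
  sub-+ (subpolynomial p) (subpolynomial q) = subpolynomial λ ε 0<ε →
    Eventually-map₂
      (λ n (a , b) 2≤ → ≤-trans (∣x+y∣≤ a b)
        (≤-respʳ-≈ (power-half ε n)
          (≤-by (0≤* (0≤power (half ε) n) (≤⇒0≤- 2≤))
                  (solve 1 (λ x → x :* x :- (x :+ x) := x :* (x :- con (+ 2)))
                  refl (power (half ε) n)))))
      (Eventually-∧ (p (half ε) (0<half 0<ε)) (q (half ε) (0<half 0<ε)))
      (power-unbounded (0<half 0<ε) 2#)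

  sub-* : ∀ {f g} → Subpolynomial f → Subpolynomial g → Subpolynomial (λ n → f n * g n)
  sub-* (subpolynomial p) (subpolynomial q) = subpolynomial λ ε 0<ε →
    Eventually-map₂ (λ n a b → ≤-respʳ-≈ (power-half ε n) (∣x*y∣≤ a b))
      (p (half ε) (0<half 0<ε)) (q (half ε) (0<half 0<ε))

  sub-neg : ∀ {f} → Subpolynomial f → Subpolynomial (λ n → - f n)
  sub-neg = sub-≤ (0 , λ n _ → ≈⇒≤ (∣-x∣≈∣x∣ _))

  -- With d = ε / 2, squaring 1 + d log n ≤ n^d gives d² (log n)² ≤ n^ε, and the left side exceeds
  -- log n once log n ≥ 1 / d².
  sub-L : Subpolynomial L
  sub-L = subpolynomial λ ε 0<ε →
    let d = half ε
        0<d = 0<half 0<ε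
        0<dd = 0<* 0<d 0<d
    in Eventually-map₂
      (λ n 0≤L big → ≤-respˡ-≈ (sym (0≤x⇒∣x∣≈x 0≤L)) (≤-respʳ-≈ (power-half ε n)
        (≤-trans
          (≤-by (0≤+ (0≤+ (0≤+ (0≤* 0≤L (≤⇒0≤- (≈⇒≥ (/-cancel 1# (0<⇒≉0 0<dd))))) (0≤*
                  (0≤* 0≤L (<⇒≤ 0<dd)) (≤⇒0≤- big))) (0≤* (0≤* (0≤ℕ 2) (<⇒≤ 0<d)) 0≤L)) 0≤1)
                  (solve 3 (λ x y z → (con (+ 1) :+ x :* y) :* (con (+ 1) :+ x :* y) :- y := y :* (z
                  :* (x :* x) :- con (+ 1)) :+ y :* (x :* x) :* (y :- z) :+ con (+ 2) :* x :* y
                  :+ con (+ 1)) refl d (L n) (1# / (d * d))))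
          (*-mono-≤ (0≤1+dL d n (<⇒≤ 0<d) 0≤L) (0≤1+dL d n (<⇒≤ 0<d) 0≤L) (1+x≤exp (d * L n)) (1+x≤exp (d * L n))))))
      0≤L (L-unbounded (1# / (d * d)))
    where
    0≤1+dL : ∀ d n → 0# ≤ d → 0# ≤ L n → 0# ≤ 1# + d * L n
    0≤1+dL d n 0≤d 0≤L = 0≤+ 0≤1 (0≤* 0≤d 0≤L)

  small-cong : ∀ {f g} → Eventually (λ n → f n ≈ g n) → PowerSmall f → PowerSmall g
  small-cong f≈g (powerSmall γ 0<γ b) = powerSmall γ 0<γ
    (Eventually-map₂ (λ n e p → ≤-respˡ-≈ (∣∣-cong e) p) f≈g b)

  small-≤ : ∀ {f g} → Eventually (λ n → ∣ f n ∣ ≤ ∣ g n ∣) → PowerSmall g → PowerSmall f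
  small-≤ f≤g (powerSmall γ 0<γ b) = powerSmall γ 0<γ (Eventually-map₂ (λ n → ≤-trans) f≤g b)

  small⇒sub : ∀ {f} → PowerSmall f → Subpolynomial f
  small⇒sub (powerSmall γ 0<γ b) = subpolynomial λ ε 0<ε →
    Eventually-map₂ (λ n p 0≤L → ≤-trans p (power-mono n 0≤L
      (≤-by (0≤+ (<⇒≤ 0<γ) (<⇒≤ 0<ε)) (solve 2 (λ x y → x :- :- y := y :+ x) refl ε γ)))) b 0≤L

  -- Half of the rate of `g` is spent on bounding `f`, the other half remains.
  sub*small : ∀ {f g} → Subpolynomial f → PowerSmall g → PowerSmall (λ n → f n * g n)
  sub*small (subpolynomial p) (powerSmall γ 0<γ q) = powerSmall (half γ) (0<half 0<γ)
    (Eventually-map₂ (λ n a b → ≤-respʳ-≈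
        (trans (sym (power-+ _ _ n)) (power-cong n (trans (+-congˡ (-‿cong (sym (half+half γ))))
          (solve 1 (λ x → x :- (x :+ x) := :- x) refl (half γ)))))
        (∣x*y∣≤ a b))
      (p (half γ) (0<half 0<γ)) q)

  small*sub : ∀ {f g} → PowerSmall f → Subpolynomial g → PowerSmall (λ n → f n * g n)
  small*sub p q = small-cong (0 , λ n _ → *-comm _ _) (sub*small q p)

  small-+ : ∀ {f g} → PowerSmall f → PowerSmall g → PowerSmall (λ n → f n + g n)
  small-+ {f} {g} (powerSmall γ₁ 0<γ₁ p) (powerSmall γ₂ 0<γ₂ q) =
    let γ , 0<γ , γ≤γ₁ , γ≤γ₂ = common-lower 0<γ₁ 0<γ₂
    in small-≤
      (Eventually-map₂ (λ n (a , b) 0≤L → ≤-respʳ-≈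
          (sym (trans (∣x*y∣≈∣x∣*∣y∣ _ _) (*-cong (0≤x⇒∣x∣≈x (<⇒≤ 0<2)) (∣power∣ (- γ) n))))
          (≤-trans (∣x+y∣≤ (≤-trans a (weaken n 0≤L γ≤γ₁)) (≤-trans b (weaken n 0≤L γ≤γ₂)))
            (≈⇒≤ (solve 1 (λ x → x :+ x := con (+ 2) :* x) refl (power (- γ) n)))))
        (Eventually-∧ p q) 0≤L)
      (sub*small (sub-const 2#) (powerSmall γ 0<γ (0 , λ n _ → ≈⇒≤ (∣power∣ (- γ) n))))
    where
    weaken : ∀ {γ γ′} n → 0# ≤ L n → γ ≤ γ′ → power (- γ′) n ≤ power (- γ) n
    weaken {γ} {γ′} n 0≤L γ≤γ′ = power-mono n 0≤L (≤-by (≤⇒0≤- γ≤γ′)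
            (solve 2 (λ x y → :- x :- :- y := y :- x) refl γ γ′))

  small-neg : ∀ {f} → PowerSmall f → PowerSmall (λ n → - f n)
  small-neg = small-≤ (0 , λ n _ → ≈⇒≤ (∣-x∣≈∣x∣ _))

  small-power : ∀ {α} → α < 0# → PowerSmall (power α)
  small-power {α} α<0 = powerSmall (- α) 0<-α (0 , λ n _ → ≈⇒≤ (trans (∣power∣ α n)
      (power-cong n (solve 1 (λ x → x := :- (:- x)) refl α))))
    where
    0<-α : 0# < - α
    0<-α = <-≤-trans (<⇒0<- α<0) (≈⇒≤ (+-identityˡ _))

  small-0 : PowerSmall (λ _ → 0#)
  small-0 = powerSmall 1# 0<1 (0 , λ n _ → ≤-respˡ-≈ (sym (0≤x⇒∣x∣≈x ≤-refl)) (0≤power _ n))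

  small-suc : ∀ {f} → PowerSmall f → PowerSmall (λ n → f (suc n))
  small-suc {f} (powerSmall γ 0<γ b) = powerSmall γ 0<γ
    (Eventually-map₂ (λ n p 1≤n → ≤-trans p (exp-mono
       (≤-by (0≤* (<⇒≤ 0<γ) (≤⇒0≤- (L-mono n 1≤n)))
               (solve 3 (λ x y z → :- x :* y :- :- x :* z := x :* (z :- y))
               refl γ (L n) (L (suc n))))))
      (Eventually-suc b) positive)

  1/n : ℕ → ℝ
  1/n n = fromℕ n ⁻¹

  1/n≈power : ∀ n → 1 ℕ.≤ n → 1/n n ≈ power (- 1#) n
  1/n≈power n 1≤n = ⁻¹-unique (trans (*-congʳ (sym (power-1 n 1≤n))) (power-inverse 1# n))

  small-1/n : PowerSmall 1/n
  small-1/n = small-cong (Eventually-map (λ n 1≤n → sym (1/n≈power n 1≤n)) positive)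
    (small-power (0<-⇒< (<-≤-trans 0<1 (≈⇒≤
            (solve 1 (λ x → con (+ 1) := con (+ 0) :- :- con (+ 1)) refl 0#)))))

  notSmall-* : ∀ {f g} → NotPowerSmall f → NotPowerSmall g → NotPowerSmall (λ n → f n * g n)
  notSmall-* (notPowerSmall p) (notPowerSmall q) = notPowerSmall λ ε 0<ε →
    Eventually-map₂ (λ n a b → ≤-respˡ-≈
        (trans (sym (power-+ _ _ n)) (power-cong n (trans
                (solve 1 (λ x → :- x :+ :- x := :- (x :+ x))
                refl (half ε)) (-‿cong (half+half ε)))))
        (*-mono-≤ (0≤power _ n) (0≤power _ n) a b))
      (p (half ε) (0<half 0<ε)) (q (half ε) (0<half 0<ε))

  -- The comparison by which main terms beat errors: the rate of `f` serves as the ε for `g`.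
  small≤notSmall : ∀ {f g} → PowerSmall f → NotPowerSmall g → Eventually (λ n → ∣ f n ∣ ≤ g n)
  small≤notSmall (powerSmall γ 0<γ p) (notPowerSmall q) = Eventually-map₂ (λ n → ≤-trans) p (q γ 0<γ)

  -- Equality of subpolynomial sequences up to O(n^(-γ)) for some γ > 0.
  infix 4 _≋_
  record _≋_ (f g : ℕ → ℝ) : Set where
    constructor congruent
    field
      sub        : Subpolynomial g
      difference : PowerSmall (λ n → f n - g n)

  ≋-refl : ∀ {f} → Subpolynomial f → f ≋ f
  ≋-refl s = congruent s (small-cong (0 , λ n _ → sym (-‿inverseʳ _)) small-0)

  ≋-cong : ∀ {f f′ g g′} → Eventually (λ n → f n ≈ f′ n) → Eventually (λ n → g n ≈ g′ n) → f ≋ g → f′ ≋ g′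
  ≋-cong f≈ g≈ (congruent s z) = congruent (sub-cong g≈ s)
    (small-cong (Eventually-map₂ (λ n p q → +-cong p (-‿cong q)) f≈ g≈) z)

  ≋-const : ∀ c → (λ _ → c) ≋ (λ _ → c)
  ≋-const c = ≋-refl (sub-const c)

  sub-left : ∀ {f g} → f ≋ g → Subpolynomial f
  sub-left {f} {g} (congruent s z) = sub-cong (0 , λ n _ →
          (solve 2 (λ x y → x :+ (y :- x) := y) refl (g n) (f n)))
    (sub-+ s (small⇒sub z))

  ≋-+ : ∀ {f f′ g g′} → f ≋ f′ → g ≋ g′ → (λ n → f n + g n) ≋ (λ n → f′ n + g′ n)
  ≋-+ {f} {f′} {g} {g′} (congruent s z) (congruent s′ z′) = congruent (sub-+ s s′)
    (small-cong (0 , λ n _ → (solve 4 (λ x y z u → x :- y :+ (z :- u) := x :+ z :- (y :+ u))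
            refl (f n) (f′ n) (g n) (g′ n)))
      (small-+ z z′))

  ≋-neg : ∀ {f g} → f ≋ g → (λ n → - f n) ≋ (λ n → - g n)
  ≋-neg {f} {g} (congruent s z) = congruent (sub-neg s)
    (small-cong (0 , λ n _ → (solve 2 (λ x y → :- (x :- y) := :- x :- :- y)
            refl (f n) (g n))) (small-neg z))

  ≋-* : ∀ {f f′ g g′} → f ≋ f′ → g ≋ g′ → (λ n → f n * g n) ≋ (λ n → f′ n * g′ n)
  ≋-* {f} {f′} {g} {g′} p@(congruent s z) q@(congruent s′ z′) = congruent (sub-* s s′)
    (small-cong (0 , λ n _ → (solve 4 (λ x y z u → (x :- y) :* z :+ y :* (z :- u) := x :* z :- y
            :* u) refl (f n) (f′ n) (g n) (g′ n)))
      (small-+ (small*sub z (sub-left q)) (sub*small s z′)))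

  ≋-small : ∀ {f} → PowerSmall f → f ≋ (λ _ → 0#)
  ≋-small {f} z = congruent (sub-const 0#) (small-cong (0 , λ n _ →
          (solve 1 (λ x → x := x :- con (+ 0)) refl (f n))) z)

  ≋-trans : ∀ {f g h} → f ≋ g → g ≋ h → f ≋ h
  ≋-trans {f} {g} {h} (congruent _ z) (congruent s z′) = congruent s
    (small-cong (0 , λ n _ → (solve 3 (λ x y z → x :- y :+ (y :- z) := x :- z)
            refl (f n) (g n) (h n))) (small-+ z z′))

-- Rational functions at infinity and along log n

module RationalFunctions (em : ExcludedMiddle 0ℓ) (R : RealNumbers) (E : RealNumbers.ExpLog R) where

  open RealNumbers R
  open ExpLog E
  open OrderedField em R
  open Exponential em R E
  open Asymptotics em R E

  EventuallyReal-∧ : ∀ {P Q : ℝ → Set} → EventuallyReal P → EventuallyReal Q → EventuallyReal (λ x → P x × Q x)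
  EventuallyReal-∧ (X , p) (Y , q) =
    let Z , X≤Z , Y≤Z = common-upper X Y
    in Z , λ x Z≤x → p x (≤-trans X≤Z Z≤x) , q x (≤-trans Y≤Z Z≤x)

  EventuallyReal-map : ∀ {P Q : ℝ → Set} → (∀ x → P x → Q x) → EventuallyReal P → EventuallyReal Q
  EventuallyReal-map f (X , p) = X , λ x X≤x → f x (p x X≤x)

  large : ∀ X → EventuallyReal (X ≤_)
  large X = X , λ _ X≤x → X≤x

  AwayFromZero : (ℝ → ℝ) → Set
  AwayFromZero f = ∃[ κ ] (0# < κ × EventuallyReal (λ x → κ ≤ ∣ f x ∣))

  -- The window of length 1 covers consecutive logarithms, and for large `x` it keeps `f y`
  -- comparable with `f x`.
  VariesBy : ℝ → (ℝ → ℝ) → ℝ → Set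
  VariesBy K f x = ∀ y → x ≤ y → y ≤ x + 1# → x * ∣ f y - f x ∣ ≤ K * ((y - x) * ∣ f x ∣)

  -- A derivative-free form of f′ = O(f / x).
  SlowlyVarying : (ℝ → ℝ) → Set
  SlowlyVarying f = ∃[ K ] (0# ≤ K × EventuallyReal (VariesBy K f))

  away⇒≉0 : ∀ {x κ} → 0# < κ → κ ≤ ∣ x ∣ → x ≉ 0#
  away⇒≉0 0<κ κ≤ x≈0 = <⇒≱ 0<κ (≤-trans κ≤ (≈⇒≤ (trans (∣∣-cong x≈0) (0≤x⇒∣x∣≈x ≤-refl))))

  Nonzero : Polynomial → Set
  Nonzero = Any (_≉ 0#)

  evalPoly-zero : ∀ {p} → ¬ Nonzero p → ∀ x → evalPoly p x ≈ 0#
  evalPoly-zero {[]}    _     x = refl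
  evalPoly-zero {c ∷ p} ¬any x with em {c ≈ 0#}
  ... | no  c≉0 = contradiction (here c≉0) ¬any
  ... | yes c≈0 = trans (+-cong c≈0 (trans (*-congˡ (evalPoly-zero (¬any ∘ there) x)) (zeroʳ x))) (+-identityˡ 0#)

  ≉0⇒0<∣∣ : ∀ {x} → x ≉ 0# → 0# < ∣ x ∣
  ≉0⇒0<∣∣ {x} x≉0 = 0≤∣x∣ x , λ 0≈∣x∣ → x≉0 (antisym (≤-trans (x≤∣x∣ x) (≈⇒≥ 0≈∣x∣))
    (0≤-by (≤⇒0≤- (≤-trans (-x≤∣x∣ x) (≈⇒≥ 0≈∣x∣)))
            (solve 1 (λ x → x := con (+ 0) :- :- x) refl x)))

  ∣horner∣≥ : ∀ c q {x} → 0# ≤ x → x * ∣ q ∣ - ∣ c ∣ ≤ ∣ c + x * q ∣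
  ∣horner∣≥ c q {x} 0≤x =
    (≤-by (≤⇒0≤- (≤-respˡ-≈ (trans (∣∣-cong
            (solve 3 (λ x y z → x :+ y :* z :- x := y :* z) refl c x q))
                (trans (∣x*y∣≈∣x∣*∣y∣ x q) (*-congʳ (0≤x⇒∣x∣≈x 0≤x))))
                (∣x-y∣≤∣x∣+∣y∣ (c + x * q) c)))
                        (solve 4 (λ x y z u → x :- (y :* z :- u) := x :+ u :- y :* z)
                        refl (∣ c + x * q ∣) x (∣ q ∣) (∣ c ∣)))

  -- Either the tail is the zero polynomial and a nonzero constant is left, or the tail stays above
  -- some κ and x κ - ∣ c ∣ reaches 1 at x = (1 + ∣ c ∣) / κ.
  evalPoly-away : ∀ {p} → Nonzero p → AwayFromZero (evalPoly p)
  evalPoly-away {c ∷ p} any with em {Nonzero p}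
  evalPoly-away {c ∷ p} (here c≉0)  | no ¬any = ∣ c ∣ , ≉0⇒0<∣∣ c≉0 , 0# , λ x _ →
    ≈⇒≤ (∣∣-cong (sym (trans (+-congˡ (trans (*-congˡ (evalPoly-zero ¬any x)) (zeroʳ x))) (+-identityʳ c))))
  evalPoly-away {c ∷ p} (there any) | no ¬any = contradiction any ¬any
  evalPoly-away {c ∷ p} _           | yes any with evalPoly-away any
  ... | κ , 0<κ , bound = 1# , 0<1 , EventuallyReal-map
    (λ x ((κ≤ , 0≤x) , big) → ≤-trans
      (≤-by (0≤+ (0≤+ (0≤* 0≤x (≤⇒0≤- κ≤)) (0≤* (≤⇒0≤- big) (<⇒≤ 0<κ)))
              (≤⇒0≤- (≈⇒≥ (/-cancel (1# + ∣ c ∣) (0<⇒≉0 0<κ)))))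
              (solve 5 (λ x y z u v → x :* y :- z :- con (+ 1) := x :* (y :- u) :+ (x :- v) :* u
              :+ (v :* u :- (con (+ 1) :+ z)))
              refl x (∣ evalPoly p x ∣) (∣ c ∣) κ ((1# + ∣ c ∣) / κ)))
      (∣horner∣≥ c (evalPoly p x) 0≤x))
    (EventuallyReal-∧ (EventuallyReal-∧ bound (large 0#)) (large ((1# + ∣ c ∣) / κ)))

  constant-slow : ∀ {f c} → (∀ x → f x ≈ c) → SlowlyVarying f
  constant-slow {f} {c} f≈c = 0# , ≤-refl , 0# , λ x _ y _ _ →
    ≈⇒≤ (trans (*-congˡ (trans (∣∣-cong (trans (+-cong (f≈c y) (-‿cong (f≈c x))) (-‿inverseʳ c))) (0≤x⇒∣x∣≈x ≤-refl)))
      (trans (zeroʳ x) (sym (zeroˡ _))))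

  -- The increment of x q is x Δq + (y - x) (q x + Δq), which contributes K + (1 + K) relative to x
  -- ∣ q x ∣. As `q` stays away from 0, the constant `c` is eventually dominated and x ∣ q x ∣ ≤ 2 ∣
  -- c + x q x ∣; hence the outer factor 2.
  horner-slow : ∀ c {q} → AwayFromZero q → SlowlyVarying q → SlowlyVarying (λ x → c + x * q x)
  horner-slow c {q} (κ , 0<κ , away) (K , 0≤K , slow) = 2# * (2# * K + 1#) ,
    0≤* (<⇒≤ 0<2) (0≤+ (0≤* (<⇒≤ 0<2) 0≤K) 0≤1) ,
    EventuallyReal-map estimate
      (EventuallyReal-∧ (EventuallyReal-∧ away slow) (EventuallyReal-∧ (large 1#) (large (2# * ∣ c ∣ / κ))))
    where
    estimate : ∀ x → (κ ≤ ∣ q x ∣ × VariesBy K q x) × (1# ≤ x × 2# * ∣ c ∣ / κ ≤ x) →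
               VariesBy (2# * (2# * K + 1#)) (λ x → c + x * q x) x
    estimate x ((κ≤ , vary) , (1≤x , big)) y x≤y y≤x+1 = ≤-trans
      (*-mono-≤ 0≤x (0≤∣x∣ _) ≤-refl ∣Δ∣≤)
      (≤-trans
        (≤-by (0≤+ (0≤* 0≤x (≤⇒0≤- (vary y x≤y y≤x+1))) (0≤* (0≤* 0≤x (≤⇒0≤- x≤y)) (≤⇒0≤- d≤KQ)))
                (solve 5 (λ x y z u v → x :* y :* ((z :- x) :* (con (+ 2) :* u :+ con (+ 1))) :- x
                :* (x :* v :+ (z :- x) :* (y :+ v)) := x :* (u :* ((z :- x) :* y) :- x :* v) :+ x
                :* (z :- x) :* (u :* y :- v)) refl x Q y K d))
        (≤-by (0≤* (0≤* (≤⇒0≤- x≤y) (0≤+ (0≤* (0≤ℕ 2) 0≤K) 0≤1)) (≤⇒0≤- xQ≤2P))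
                (solve 5 (λ x y z u v → con (+ 2) :* (con (+ 2) :* x :+ con (+ 1)) :* ((y :- z)
                :* u) :- z :* v :* ((y :- z) :* (con (+ 2) :* x :+ con (+ 1))) := (y :- z)
                :* (con (+ 2) :* x :+ con (+ 1)) :* (con (+ 2) :* u :- z :* v)) refl K y x P Q)))
      where
      d = ∣ q y - q x ∣
      Q = ∣ q x ∣
      P = ∣ c + x * q x ∣

      0≤x : 0# ≤ x
      0≤x = ≤-trans 0≤1 1≤x

      -- Uses `vary` with x ≥ 1 on its left and y - x ≤ 1 on its right.
      d≤KQ : d ≤ K * Q
      d≤KQ = (≤-by (0≤+ (0≤+ (0≤* (≤⇒0≤- 1≤x) (0≤∣x∣ (q y - q x))) (≤⇒0≤- (vary y x≤y y≤x+1))) (0≤*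
              (0≤* 0≤K (0≤∣x∣ (q x))) (≤⇒0≤- y≤x+1)))
              (solve 5 (λ x y z u v → x :* y :- z := (u :- con (+ 1)) :* z :+ (x :* ((v :- u) :* y)
              :- u :* z) :+ x :* y :* (u :+ con (+ 1) :- v)) refl K Q d x y))

      xQ≤2P : x * Q ≤ 2# * P
      xQ≤2P = (≤-by (0≤+ (0≤+ (0≤+ (0≤* (0≤ℕ 2) (≤⇒0≤- (∣horner∣≥ c (q x) 0≤x))) (0≤* 0≤x
              (≤⇒0≤- κ≤))) (0≤* (≤⇒0≤- big) (<⇒≤ 0<κ)))
              (≤⇒0≤- (≈⇒≥ (/-cancel (2# * ∣ c ∣) (0<⇒≉0 0<κ)))))
              (solve 6 (λ x y z u v w → con (+ 2) :* x :- y :* z := con (+ 2) :* (x :- (y :* z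
              :- u)) :+ y :* (z :- v) :+ (y :- w) :* v :+ (w :* v :- con (+ 2) :* u))
              refl P x Q (∣ c ∣) κ (2# * ∣ c ∣ / κ)))

      ∣Δ∣≤ : ∣ (c + y * q y) - (c + x * q x) ∣ ≤ x * d + (y - x) * (Q + d)
      ∣Δ∣≤ = ≤-respˡ-≈
        (∣∣-cong (solve 5 (λ x y z u v → x :* (y :- z) :+ (u :- x) :* (z :+ (y :- z)) := v :+ u :* y
                :- (v :+ x :* z)) refl x (q y) (q x) y c))
        (∣x+y∣≤ (∣x*y∣≤ (≈⇒≤ (0≤x⇒∣x∣≈x 0≤x)) ≤-refl)
                (∣x*y∣≤ (≈⇒≤ (0≤x⇒∣x∣≈x (≤⇒0≤- x≤y))) (∣x+y∣≤∣x∣+∣y∣ _ _)))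

  evalPoly-slow : ∀ p → SlowlyVarying (evalPoly p)
  evalPoly-slow [] = constant-slow (λ _ → refl)
  evalPoly-slow (c ∷ p) with em {Nonzero p}
  ... | yes any  = horner-slow c (evalPoly-away any) (evalPoly-slow p)
  ... | no  ¬any = constant-slow λ x →
    trans (+-congˡ (trans (*-congˡ (evalPoly-zero ¬any x)) (zeroʳ x))) (+-identityʳ c)

  -- Over the common denominator the increment has numerator Δf g x - f x Δg, so relative rates add
  -- up to K + M; replacing ∣ g y ∣ by ∣ g x ∣ costs the factor 2.
  /-slow : ∀ {f g} → SlowlyVarying f → SlowlyVarying g → AwayFromZero g → SlowlyVarying (λ x → f x / g x)
  /-slow {f} {g} (K , 0≤K , slow-f) (M , 0≤M , slow-g) (κ , 0<κ , away) = 2# * (K + M) ,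
    0≤* (<⇒≤ 0<2) (0≤+ 0≤K 0≤M) ,
    EventuallyReal-map estimate (EventuallyReal-∧ (EventuallyReal-∧ slow-f slow-g)
      -- The denominator must not vanish at `y` either, so its bound is kept for every argument
      -- beyond `x`.
      (EventuallyReal-∧ (proj₁ away , λ x X≤x y x≤y → proj₂ away y (≤-trans X≤x x≤y))
        (EventuallyReal-∧ (large (2# * M)) (large 1#))))
    where
    estimate : ∀ x → (VariesBy K f x × VariesBy M g x) × ((∀ y → x ≤ y → κ ≤ ∣ g y ∣) × (2# * M ≤ x × 1# ≤ x)) →
               VariesBy (2# * (K + M)) (λ x → f x / g x) x
    estimate x ((vary-f , vary-g) , (κ≤ , (2M≤x , 1≤x))) y x≤y y≤x+1 = *-cancel-≤ (0<* 0<G 0<G′)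
      (≤-trans
        (≤-respˡ-≈ (trans (*-congʳ ∣product∣)
                (solve 4 (λ x y z u → x :* (y :* z) :* u := y :* z :* (u :* x)) refl e G G′ x))
          (≤-by (0≤+ (0≤+ (0≤* (≤⇒0≤- n≤) (≤-trans 0≤1 1≤x)) (0≤* (≤⇒0≤- (vary-f y x≤y y≤x+1))
                  (0≤∣x∣ (g x)))) (0≤* (0≤∣x∣ (f x)) (≤⇒0≤- (vary-g y x≤y y≤x+1))))
                  (solve 9 (λ x y z u v w s t p → (x :+ y) :* ((z :- u) :* (v :* w)) :- s :* u := (t
                  :* w :+ v :* p :- s) :* u :+ (x :* ((z :- u) :* v) :- u :* t) :* w :+ v :* (y
                  :* ((z :- u) :* w) :- u :* p)) refl K M y x F G n ΔF ΔG)))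
        (≤-trans (≈⇒≤ (*-congˡ (*-congˡ (*-congʳ F≈QG))))
          (≤-by (0≤* (0≤* (0≤* (0≤* (0≤+ 0≤K 0≤M) (≤⇒0≤- x≤y)) (0≤∣x∣ (f x / g x))) (0≤∣x∣ (g x)))
                  (≤⇒0≤- G≤2G′))
                  (solve 7 (λ x y z u v w s → x :* y :* (con (+ 2) :* (z :+ u) :* ((v :- w) :* s))
                  :- (z :+ u) :* ((v :- w) :* (s :* x :* x)) := (z :+ u) :* (v :- w) :* s :* x
                  :* (con (+ 2) :* y :- x)) refl G G′ K M y x Q))))
      where
      F = ∣ f x ∣
      G = ∣ g x ∣
      G′ = ∣ g y ∣
      ΔF = ∣ f y - f x ∣
      ΔG = ∣ g y - g x ∣
      Q = ∣ f x / g x ∣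
      e = ∣ f y / g y - f x / g x ∣
      n = ∣ (f y - f x) * g x - f x * (g y - g x) ∣

      gx≉0 : g x ≉ 0#
      gx≉0 = away⇒≉0 0<κ (κ≤ x ≤-refl)

      gy≉0 : g y ≉ 0#
      gy≉0 = away⇒≉0 0<κ (κ≤ y x≤y)

      0<G : 0# < G
      0<G = ≉0⇒0<∣∣ gx≉0

      0<G′ : 0# < G′
      0<G′ = ≉0⇒0<∣∣ gy≉0

      F≈QG : F ≈ Q * G
      F≈QG = trans (∣∣-cong (sym (/-cancel (f x) gx≉0))) (∣x*y∣≈∣x∣*∣y∣ _ _)

      n≤ : n ≤ ΔF * G + F * ΔG
      n≤ = ≤-trans (∣x-y∣≤∣x∣+∣y∣ _ _) (≈⇒≤ (+-cong (∣x*y∣≈∣x∣*∣y∣ _ _) (∣x*y∣≈∣x∣*∣y∣ _ _)))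

      ∣product∣ : n ≈ e * (G * G′)
      ∣product∣ = trans (∣∣-cong (trans
          (solve 4 (λ x y z u → (x :- y) :* z :- y :* (u :- z) := x :* z :- y :* u)
                  refl (f y) (f x) (g x) (g y))
          (trans (+-cong (*-congʳ (sym (/-cancel (f y) gy≉0))) (-‿cong (*-congʳ (sym (/-cancel (f x) gx≉0)))))
            (solve 4 (λ x y z u → x :* y :* z :- u :* z :* y := (x :- u) :* (z :* y))
                    refl (f y / g y) (g y) (g x) (f x / g x)))))
        (trans (∣x*y∣≈∣x∣*∣y∣ _ _) (*-congˡ (∣x*y∣≈∣x∣*∣y∣ _ _)))

      -- For x ≥ 2 M and y - x ≤ 1 the denominator changes by at most half of its size.
      2ΔG≤G : 2# * ΔG ≤ G
      2ΔG≤G = *-cancel-≤ (<-≤-trans 0<1 1≤x)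
        (≤-by (0≤+ (0≤+ (0≤* (0≤ℕ 2) (≤⇒0≤- (vary-g y x≤y y≤x+1))) (0≤* (0≤* (0≤* (0≤ℕ 2) 0≤M)
                (0≤∣x∣ (g x))) (≤⇒0≤- y≤x+1))) (0≤* (≤⇒0≤- 2M≤x) (0≤∣x∣ (g x))))
                (solve 5 (λ x y z u v → x :* y :- x :* (con (+ 2) :* z) := con (+ 2) :* (u :* ((v
                :- x) :* y) :- x :* z) :+ con (+ 2) :* u :* y :* (x :+ con (+ 1) :- v) :+ (x
                :- con (+ 2) :* u) :* y) refl x G ΔG M y))

      G≤2G′ : G ≤ 2# * G′
      G≤2G′ = (≤-by (0≤+ (0≤* (0≤ℕ 2) (≤⇒0≤- (≤-respˡ-≈ (∣∣-cong
              (solve 2 (λ x y → x :- (x :- y) := y)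
              refl (g y) (g x))) (∣x-y∣≤∣x∣+∣y∣ (g y) (g y - g x))))) (≤⇒0≤- 2ΔG≤G))
              (solve 3 (λ x y z → con (+ 2) :* x :- y := con (+ 2) :* (x :+ z :- y) :+ (y
              :- con (+ 2) :* z)) refl G′ G ΔG))

  -- n times the step of the logarithm is at most 1, so slow variation leaves the factor K / log n,
  -- which falls below any ε.
  slow-along-L : ∀ {f} → SlowlyVarying f → ∀ {ε} → 0# < ε →
                 Eventually (λ n → ∣ fromℕ n * (f (L n) - f (L (suc n))) ∣ ≤ ε * ∣ f (L n) ∣)
  slow-along-L {f} (K , 0≤K , slow) {ε} 0<ε = Eventually-map₂
    (λ n (1≤n , 1≤L) (vary , big) →
      let x = L n
          N = fromℕ n
          d = ∣ f (L (suc n)) - f x ∣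
          0≤N = 0≤fromℕ n
          h≤1 = *-cancel-≤ (0<fromℕ 1≤n)
            (≤-by (0≤+ (≤⇒0≤- (L-step-upper n 1≤n)) (≤⇒0≤-
                    (≤-respˡ-≈ (+-identityʳ 1#) (fromℕ-mono 1≤n))))
                    (solve 3 (λ x y z → x :* con (+ 1) :- x :* (y :- z) := con (+ 1) :- x :* (y
                    :- z) :+ (x :- con (+ 1))) refl N (L (suc n)) x))
      in ≤-respˡ-≈ (sym (trans (∣x*y∣≈∣x∣*∣y∣ _ _) (*-cong (0≤x⇒∣x∣≈x 0≤N) (∣x-y∣≈∣y-x∣ _ _))))
        (*-cancel-≤ (<-≤-trans 0<1 1≤L)
          (≤-by (0≤+ (0≤+ (0≤+ (0≤* 0≤N (≤⇒0≤- (vary (L (suc n)) (L-mono n 1≤n)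
                     (≤-by (≤⇒0≤- h≤1) (solve 2 (λ x y → x :+ con (+ 1) :- y := con (+ 1) :- (y
                             :- x)) refl x (L (suc n))))))) (0≤* (0≤* 0≤K (0≤∣x∣ (f x)))
                             (≤⇒0≤- (L-step-upper n 1≤n)))) (0≤* (0≤* (0≤∣x∣ (f x)) (<⇒≤ 0<ε))
                             (≤⇒0≤- big))) (0≤* (0≤∣x∣ (f x))
                             (≤⇒0≤- (≈⇒≥ (/-cancel K (0<⇒≉0 0<ε))))))
                             (solve 8 (λ x y z u v w s t → x :* (y :* z) :- x :* (u :* v) := u :* (w
                             :* ((s :- x) :* z) :- x :* v) :+ w :* z :* (con (+ 1) :- u :* (s :- x))
                             :+ z :* y :* (x :- t) :+ z :* (t :* y :- w))
                             refl x ε (∣ f x ∣) N d K (L (suc n)) (K / ε)))))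
    (Eventually-∧ positive (L-unbounded 1#))
    (Eventually-∧ (eventually-log slow) (L-unbounded (K / ε)))

  sub-evalPoly : ∀ p → Subpolynomial (λ n → evalPoly p (L n))
  sub-evalPoly []      = sub-const 0#
  sub-evalPoly (c ∷ p) = sub-+ (sub-const c) (sub-* sub-L (sub-evalPoly p))

  module _ (r : RationalFunction) where
    open RationalFunction r

    denominator-away : AwayFromZero (evalPoly denominator)
    denominator-away = evalPoly-away nonzero

    denominator-≉0 : EventuallyReal (λ x → evalPoly denominator x ≉ 0#)
    denominator-≉0 =
      let κ , 0<κ , away = denominator-away
      in EventuallyReal-map (λ x → away⇒≉0 0<κ) away

    eval-slow : SlowlyVarying (eval r)
    eval-slow = /-slow (evalPoly-slow numerator) (evalPoly-slow denominator) denominator-away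

    sub-eval : Subpolynomial (λ n → eval r (L n))
    sub-eval =
      let κ , 0<κ , away = denominator-away
      in sub-* (sub-evalPoly numerator) (sub-≤
        (Eventually-map (λ n κ≤ →
           let D = evalPoly denominator (L n)
               D≉0 = away⇒≉0 0<κ κ≤
           in ≤-trans (*-cancel-≤ 0<κ
             (≤-by (0≤+ (0≤+ (0≤* (≤⇒0≤- κ≤) (0≤∣x∣ (D ⁻¹))) (≤⇒0≤- (≈⇒≤ (∣⁻¹∣ D≉0))))
                     (≤⇒0≤- (≈⇒≥ (⁻¹-inverse κ (0<⇒≉0 0<κ)))))
                     (solve 4 (λ x y z u → x :* y :- x :* z := (u :- x) :* z :+ (con (+ 1) :- z
                     :* u) :+ (x :* y :- con (+ 1))) refl κ (κ ⁻¹) (∣ D ⁻¹ ∣) (∣ D ∣)))) (x≤∣x∣ _))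
          (eventually-log away))
        (sub-const (κ ⁻¹)))

    -- The numerator is not the zero polynomial, so it stays above some κ, while the denominator is
    -- at most n^(ε/2); the quotient is at least κ n^(-ε/2) in size, eventually more than n^(-ε).
    -- The hypothesis fixes the sign.
    notSmall-eval : EventuallyReal (λ x → eval r x < 0#) → NotPowerSmall (λ n → - eval r (L n))
    notSmall-eval r<0 with em {Nonzero numerator}
    ... | no ¬any = contradiction
      (≈⇒≥ (trans (*-congʳ (evalPoly-zero ¬any (proj₁ r<0))) (zeroˡ _)))
      (<⇒≱ (proj₂ r<0 (proj₁ r<0) ≤-refl))
    ... | yes any =
      let κ , 0<κ , away = evalPoly-away any
      in notPowerSmall λ ε 0<ε → Eventually-map₂
        (λ n ((r<0 , D≉0) , κ≤) (D≤ , big) →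
          let D = evalPoly denominator (L n)
              N = evalPoly numerator (L n)
              q = - eval r (L n)
              p = power (half ε) n
              m = power (- ε) n
              p*p*m≈1 = trans (*-congʳ (power-half ε n)) (power-inverse ε n)
              0<p = 0<power (half ε) n
              0<m = 0<power (- ε) n
          in *-cancel-≤ (≉0⇒0<∣∣ D≉0) (≤-trans
               (*-cancel-≤ 0<p
                 (≤-by (0≤+ (0≤+ (0≤+ (0≤* (0≤* (<⇒≤ 0<p) (<⇒≤ 0<m)) (≤⇒0≤- D≤))
                         (≤⇒0≤- (≈⇒≤ p*p*m≈1))) (≤⇒0≤- (≈⇒≥ (⁻¹-inverse κ (0<⇒≉0 0<κ)))))
                         (0≤* (<⇒≤ 0<κ) (≤⇒0≤- big)))
                         (solve 5 (λ x y z u v → x :* y :- x :* (z :* u) := x :* u :* (x :- z)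
                         :+ (con (+ 1) :- x :* x :* u) :+ (y :* v :- con (+ 1)) :+ y :* (x :- v))
                         refl p κ (∣ D ∣) m (κ ⁻¹))))
               (≤-trans κ≤ (≈⇒≤ (trans (∣∣-cong (sym (/-cancel N D≉0)))
                 (trans (∣x*y∣≈∣x∣*∣y∣ _ _) (trans (*-comm _ _) (*-congˡ (x≤0⇒∣x∣≈-x (<⇒≤ r<0))))))))))
        (Eventually-∧ (eventually-log (EventuallyReal-∧ r<0 denominator-≉0)) (eventually-log away))
        (Eventually-∧ (Subpolynomial.bound (sub-evalPoly denominator) (half ε) (0<half 0<ε))
                      (power-unbounded (0<half 0<ε) (κ ⁻¹)))

  infixl 6 _⊕_
  _⊕_ : Polynomial → Polynomial → Polynomial
  []      ⊕ q       = q
  (a ∷ p) ⊕ []      = a ∷ p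
  (a ∷ p) ⊕ (b ∷ q) = a + b ∷ p ⊕ q

  evalPoly-⊕ : ∀ p q x → evalPoly (p ⊕ q) x ≈ evalPoly p x + evalPoly q x
  evalPoly-⊕ []      q       x = sym (+-identityˡ _)
  evalPoly-⊕ (a ∷ p) []      x = sym (+-identityʳ _)
  evalPoly-⊕ (a ∷ p) (b ∷ q) x = trans (+-congˡ (*-congˡ (evalPoly-⊕ p q x)))
    (solve 5 (λ x y z u v → x :+ y :+ z :* (u :+ v) := x :+ z :* u :+ (y :+ z :* v))
            refl a b x (evalPoly p x) (evalPoly q x))

  1+_ : RationalFunction → RationalFunction
  1+ r = record { numerator = denominator ⊕ numerator ; denominator = denominator ; nonzero = nonzero }
    where open RationalFunction r

  -- Holds only eventually, since the inverse is unspecified at zeros of the denominator.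
  eval-1+ : ∀ r → EventuallyReal (λ x → eval (1+ r) x ≈ 1# + eval r x)
  eval-1+ r = EventuallyReal-map
    (λ x D≉0 → trans (*-congʳ (evalPoly-⊕ denominator numerator x))
      (trans (distribʳ _ _ _) (+-congʳ (⁻¹-inverse _ D≉0))))
    (denominator-≉0 r)
    where open RationalFunction r

-- Scaled increments and tame errors

module Turán (em : ExcludedMiddle 0ℓ) (R : RealNumbers) (E : RealNumbers.ExpLog R) where

  open RealNumbers R
  open ExpLog E
  open OrderedField em R
  open Exponential em R E
  open Asymptotics em R E
  open RationalFunctions em R E
  open Algebra.Properties.Semiring.Sum semiring using (*-distribʳ-sum)
  open Algebra.Properties.CommutativeSemiring.Exp commutativeSemiring using (^-congˡ)

  -- A discrete - x f′(x); the sign is that of x - y with y the successor of x.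
  ∇ : (ℕ → ℝ) → ℕ → ℝ
  ∇ f n = fromℕ n * (f n - f (suc n))

  ∇-cong : ∀ {f g} → Eventually (λ n → f n ≈ g n) → Eventually (λ n → ∇ f n ≈ ∇ g n)
  ∇-cong f≈g = Eventually-map₂ (λ n p q → *-congˡ (+-cong p (-‿cong q))) f≈g (Eventually-suc f≈g)

  ∇-neg : ∀ f n → ∇ (λ n → - f n) n ≈ - ∇ f n
  ∇-neg f n = (solve 3 (λ x y z → x :* (:- y :- :- z) := :- (x :* (y :- z)))
          refl (fromℕ n) (f n) (f (suc n)))

  sub-∇neg : ∀ {f} → Subpolynomial (∇ f) → Subpolynomial (∇ (λ n → - f n))
  sub-∇neg {f} s = sub-cong (0 , λ n _ → sym (∇-neg f n)) (sub-neg s)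

  -- The shift changes `f` by `∇ f n` / n, and the factor 1/n is a power saving.
  shift-≋ : ∀ {f} → Subpolynomial f → Subpolynomial (∇ f) → (λ n → f (suc n)) ≋ f
  shift-≋ {f} s s′ = congruent s (small-cong
    (Eventually-map (λ n 1≤n → trans (-‿cong (trans
            (solve 4 (λ x y z u → x :* (y :* (z :- u)) := y :* (x :* (z :- u)))
            refl (fromℕ n ⁻¹) (fromℕ n) (f n) (f (suc n)))
       (⁻¹-cancelˡ _ (0<⇒≉0 (0<fromℕ 1≤n)))))
               (solve 2 (λ x y → :- (x :- y) := y :- x) refl (f n) (f (suc n)))) positive)
    (small-neg (small*sub small-1/n s′)))

  Tame : (ℕ → ℝ) → Set
  Tame f = PowerSmall f × PowerSmall (∇ f)

  tame-cong : ∀ {f g} → Eventually (λ n → f n ≈ g n) → Tame f → Tame g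
  tame-cong f≈g (p , q) = small-cong f≈g p , small-cong (∇-cong f≈g) q

  tame-+ : ∀ {f g} → Tame f → Tame g → Tame (λ n → f n + g n)
  tame-+ {f} {g} (p , q) (p′ , q′) = small-+ p p′ , small-cong
    (0 , λ n _ → (solve 5 (λ x y z u v → x :* (y :- z) :+ x :* (u :- v) := x :* (y :+ u :- (z
            :+ v))) refl (fromℕ n) (f n) (f (suc n)) (g n) (g (suc n)))) (small-+ q q′)

  tame-neg : ∀ {f} → Tame f → Tame (λ n → - f n)
  tame-neg {f} (p , q) = small-neg p , small-cong (0 , λ n _ → sym (∇-neg f n)) (small-neg q)

  tame-0 : Tame (λ _ → 0#)
  tame-0 = small-0 , small-cong (0 , λ n _ →
          (solve 1 (λ x → con (+ 0) := x :* (con (+ 0) :- con (+ 0))) refl (fromℕ n))) small-0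

  tame-sum : ∀ {k} (f : Fin k → ℕ → ℝ) → (∀ i → Tame (f i)) → Tame (λ n → sum (λ i → f i n))
  tame-sum {zero}  f t = tame-0
  tame-sum {suc k} f t = tame-+ (t Fin.zero) (tame-sum (f ∘ Fin.suc) (t ∘ Fin.suc))

  -- Without any cancellation in the increments, the two terms of `∇ f` are bounded separately, with
  -- n f (n+1) written as (n+1) f (n+1) - f (n+1).
  tame-by-multiple : ∀ {f} → PowerSmall (λ n → fromℕ n * f n) → Tame f
  tame-by-multiple {f} z =
    small-cong
      (Eventually-map (λ n 1≤n → trans (solve 3 (λ x y z → x :* (y :* z) := y :* (x :* z))
              refl (fromℕ n ⁻¹) (fromℕ n) (f n))
        (⁻¹-cancelˡ _ (0<⇒≉0 (0<fromℕ 1≤n)))) positive)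
      (small*sub small-1/n (small⇒sub z)) ,
    small-cong
      (0 , λ n _ → trans
        (+-congˡ (-‿cong (+-congˡ (-‿cong (⁻¹-cancelˡ′ n)))))
        (solve 3 (λ x y z → x :* y :- ((con (+ 1) :+ x) :* z :- z) := x :* (y :- z))
                refl (fromℕ n) (f n) (f (suc n))))
      (small-+ z (small-neg (small-+ (small-suc z) (small-neg (small*sub (small-suc small-1/n) (small⇒sub (small-suc z)))))))
    where
    ⁻¹-cancelˡ′ : ∀ n → fromℕ (suc n) ⁻¹ * (fromℕ (suc n) * f (suc n)) ≈ f (suc n)
    ⁻¹-cancelˡ′ n = trans (solve 3 (λ x y z → x :* (y :* z) := y :* (x :* z))
            refl (fromℕ (suc n) ⁻¹) (fromℕ (suc n)) (f (suc n)))
      (⁻¹-cancelˡ _ (0<⇒≉0 (0<fromℕ-suc n)))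

  -- The quotient (n / (n+1))^γ of consecutive values of n^(-γ).
  step : ℝ → ℕ → ℝ
  step γ n = exp (- γ * (L (suc n) - L n))

  power-step : ∀ γ n → power (- γ) (suc n) ≈ power (- γ) n * step γ n
  power-step γ n = trans (exp-cong (solve 3 (λ x y z → :- x :* y := :- x :* z :+ :- x :* (y :- z))
          refl γ (L (suc n)) (L n))) (exp-+ _ _)

  module _ {γ : ℝ} (0≤γ : 0# ≤ γ) where

    L-step≤1/n : ∀ n → 1 ℕ.≤ n → L (suc n) - L n ≤ 1/n n
    L-step≤1/n n 1≤n = *-cancel-≤ 0<n (≤-respʳ-≈ (sym (⁻¹-inverse _ (0<⇒≉0 0<n))) (L-step-upper n 1≤n))
      where
      0<n : 0# < fromℕ n
      0<n = 0<fromℕ 1≤n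

    step-lower : ∀ n → 1# - γ * (L (suc n) - L n) ≤ step γ n
    step-lower n = ≤-respˡ-≈ (solve 3 (λ x y z → con (+ 1) :+ :- x :* (y :- z) := con (+ 1) :- x
            :* (y :- z)) refl γ (L (suc n)) (L n))
      (1+x≤exp (- γ * (L (suc n) - L n)))

    step-upper : ∀ n → step γ n * (1# + γ * (L (suc n) - L n)) ≤ 1#
    step-upper n = ≤-respʳ-≈ exp0≈1 (≤-respˡ-≈ (*-congˡ
      (solve 3 (λ x y z → con (+ 1) :+ (con (+ 0) :- :- x :* (y :- z)) := con (+ 1) :+ x :* (y
              :- z)) refl γ (L (suc n)) (L n)))
      (exp-strict (- γ * (L (suc n) - L n)) 0#))

    small-by-1/n : ∀ {f} c → Eventually (λ n → ∣ f n ∣ ≤ c * 1/n n) → PowerSmall f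
    small-by-1/n c p = small-≤ (Eventually-map (λ n q → ≤-trans q (x≤∣x∣ _)) p) (sub*small (sub-const c) small-1/n)

    step≋1 : step γ ≋ (λ _ → 1#)
    step≋1 = congruent (sub-const 1#) (small-by-1/n γ (Eventually-map
      (λ n 1≤n →
        let s = step γ n
            h = L (suc n) - L n
            i = 1/n n
        in ∣∣-least
          (≤-by (0≤+ (0≤+ (≤⇒0≤- (step-upper n)) (0≤* (0≤* (0≤exp _) 0≤γ) (≤⇒0≤- (L-mono n 1≤n))))
                  (0≤* 0≤γ (<⇒≤ (⁻¹-pos (0<fromℕ 1≤n)))))
                  (solve 4 (λ x y z u → x :* y :- (z :- con (+ 1)) := con (+ 1) :- z :* (con (+ 1)
                  :+ x :* u) :+ z :* x :* u :+ x :* y) refl γ i s h))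
          (≤-by (0≤+ (≤⇒0≤- (step-lower n)) (0≤* 0≤γ (≤⇒0≤- (L-step≤1/n n 1≤n))))
                  (solve 4 (λ x y z u → x :* y :- :- (z :- con (+ 1)) := z :- (con (+ 1) :- x :* u)
                  :+ x :* (y :- u)) refl γ i s h)))
      positive))

    -- For h the step of the logarithm, 1 - γ h ≤ `step γ n` ≤ 1 / (1 + γ h) and 1/(n+1) ≤ h ≤ 1/n,
    -- with total error at most (γ + γ²) / n. This is the source of the term α₁ ρ.
    n*[1-step]≋γ : (λ n → fromℕ n * (1# - step γ n)) ≋ (λ _ → γ)
    n*[1-step]≋γ = congruent (sub-const γ) (small-by-1/n (γ + γ * γ) (Eventually-map
      (λ n 1≤n →
        let N = fromℕ n
            s = step γ n
            h = L (suc n) - L n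
            i = 1/n n
            0≤h = ≤⇒0≤- (L-mono n 1≤n)
            0≤i = <⇒≤ (⁻¹-pos (0<fromℕ 1≤n))
        in ∣∣-least
          (≤-by (0≤+ (0≤+ (0≤+ (0≤* (0≤fromℕ n) (≤⇒0≤- (step-lower n))) (0≤* 0≤γ
                  (≤⇒0≤- (L-step-upper n 1≤n)))) (0≤* 0≤γ 0≤i)) (0≤* (0≤* 0≤γ 0≤γ) 0≤i))
                  (solve 5 (λ x y z u v → (x :+ x :* x) :* y :- (z :* (con (+ 1) :- u) :- x) := z
                  :* (u :- (con (+ 1) :- x :* v)) :+ x :* (con (+ 1) :- z :* v) :+ x :* y :+ x :* x
                  :* y) refl γ i N s h))
          (≤-by (0≤+ (0≤+ (0≤+ (0≤+ (0≤* (0≤fromℕ n) (≤⇒0≤- (step-upper n))) (0≤* (0≤* (0≤*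
                  (0≤fromℕ n) 0≤γ) 0≤h) (≤⇒0≤- (step-lower n)))) (0≤* 0≤γ
                  (≤⇒0≤- (L-step-lower n 1≤n)))) (0≤* (0≤* (0≤* 0≤γ 0≤γ) 0≤h)
                  (≤⇒0≤- (L-step-upper n 1≤n)))) (0≤* (0≤+ 0≤γ (0≤* 0≤γ 0≤γ))
                  (≤⇒0≤- (L-step≤1/n n 1≤n))))
                  (solve 5 (λ x y z u v → (x :+ x :* x) :* y :- :- (z :* (con (+ 1) :- u) :- x) := z
                  :* (con (+ 1) :- u :* (con (+ 1) :+ x :* v)) :+ z :* x :* v :* (u :- (con (+ 1)
                  :- x :* v)) :+ x :* ((con (+ 1) :+ z) :* v :- con (+ 1)) :+ x :* x :* v
                  :* (con (+ 1) :- z :* v) :+ (x :+ x :* x) :* (y :- v)) refl γ i N s h)))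
      positive))

  sub-∇eval : ∀ r → Subpolynomial (∇ (λ n → eval r (L n)))
  sub-∇eval r = sub-≤ (Eventually-map (λ n → ≤-respʳ-≈ (*-identityˡ _)) (slow-along-L (eval-slow r) 0<1)) (sub-eval r)

  -- Discrete product rule: one part has the increment of the coefficient, the other n (1 -
  -- `step γ n`); both factors are subpolynomial and n^(-γ) survives in each part.
  tame-term : ∀ r {γ} → 0# < γ → Tame (λ n → eval r (L n) * power (- γ) n)
  tame-term r {γ} 0<γ =
    sub*small (sub-eval r) small ,
    small-cong
      (0 , λ n _ → trans
        (solve 5 (λ x y z u v → x :* (y :- z) :* u :+ z :* (x :* (con (+ 1) :- v)) :* u := x :* (y
                :* u :- z :* (u :* v))) refl (fromℕ n) (e n) (e (suc n)) (p n) (step γ n))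
        (*-congˡ (+-congˡ (-‿cong (*-congˡ (sym (power-step γ n)))))))
      (small-+ (sub*small (sub-∇eval r) small)
        (sub*small (sub-* (sub-left (shift-≋ (sub-eval r) (sub-∇eval r))) (sub-left (n*[1-step]≋γ (<⇒≤ 0<γ)))) small))
    where
    e p : ℕ → ℝ
    e n = eval r (L n)
    p = power (- γ)

    small : PowerSmall p
    small = small-power (0<-⇒< (<-≤-trans 0<γ (≈⇒≤
            (solve 1 (λ x → x := con (+ 0) :- :- x) refl γ))))

  -- From the Turán expression to an inequality for the main term

  turán-by-ratios : ∀ {a₀ a₁ a₂ a₃ x y} → a₁ ≉ 0# → a₂ ≉ 0# →
    1# - a₀ * a₂ / a₁ ^ 2 ≈ x → 1# - a₁ * a₃ / a₂ ^ 2 ≈ y →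
    (x - y) * (x - y) ≤ x * y * (2# * (x + y) - x * y) →
    0# ≤ fromℕ 4 * ((a₁ ^ 2 - a₀ * a₂) * (a₂ ^ 2 - a₁ * a₃)) - (a₁ * a₂ - a₀ * a₃) ^ 2
  turán-by-ratios {a₀} {a₁} {a₂} {a₃} {x} {y} a₁≉0 a₂≉0 x≈ y≈ ineq = ≤-respʳ-≈
    (sym (+-cong (*-congˡ (*-cong eq₁ eq₂)) (-‿cong (^-congˡ 2 eq₃))))
    (0≤-by (0≤* (0≤x*x (a₁ * a₂)) (≤⇒0≤- ineq))
            -- `fromℕ 4` unfolds to this right-nested sum ending in 0, which is not syntactically
            -- the value of `con (+ 4)`.
            (solve 4 (λ x y z u → (con (+ 1) :+ (con (+ 1) :+ (con (+ 1) :+ (con (+ 1)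
            :+ con (+ 0))))) :* (x :* y :^ 2 :* (z :* u :^ 2)) :- (y :* u :* (x :+ z :- x
            :* z)) :^ 2 := y :* u :* (y :* u) :* (x :* z :* (con (+ 2) :* (x :+ z) :- x :* z) :- (x
            :- z) :* (x :- z))) refl x a₁ y a₂))
    where
    solve-ratio : ∀ {p q z} → q ≉ 0# → 1# - p / q ≈ z → p ≈ (1# - z) * q
    solve-ratio {p} {q} {z} q≉0 z≈ = trans (sym (/-cancel p q≉0))
      (*-congʳ (trans (solve 1 (λ x → x := con (+ 1) :- (con (+ 1) :- x))
              refl (p / q)) (+-congˡ (-‿cong z≈))))

    ^2≉0 : ∀ {a} → a ≉ 0# → a ^ 2 ≉ 0#
    ^2≉0 {a} a≉0 = ≉0-* a≉0 (≉0-* a≉0 (0<⇒≉0 0<1))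

    a₀a₂≈ = solve-ratio (^2≉0 a₁≉0) x≈
    a₁a₃≈ = solve-ratio (^2≉0 a₂≉0) y≈

    -- The product of the two ratio equations contains a₁ a₂ on both sides; cancelling it leaves the
    -- outer product.
    a₀a₃≈ : a₀ * a₃ ≈ (1# - x) * (1# - y) * (a₁ * a₂)
    a₀a₃≈ = *-cancelˡ (≉0-* a₁≉0 a₂≉0) (trans
      (solve 4 (λ x y z u → x :* y :* (z :* u) := z :* y :* (x :* u))
              refl a₁ a₂ a₀ a₃) (trans (*-cong a₀a₂≈ a₁a₃≈)
      (solve 4 (λ x y z u → (con (+ 1) :- x) :* y :^ 2 :* ((con (+ 1) :- z) :* u :^ 2) := y :* u
              :* ((con (+ 1) :- x) :* (con (+ 1) :- z) :* (y :* u))) refl x a₁ y a₂)))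

    eq₁ : a₁ ^ 2 - a₀ * a₂ ≈ x * a₁ ^ 2
    eq₁ = trans (+-congˡ (-‿cong a₀a₂≈))
            (solve 2 (λ x y → x :^ 2 :- (con (+ 1) :- y) :* x :^ 2 := y :* x :^ 2) refl a₁ x)

    eq₂ : a₂ ^ 2 - a₁ * a₃ ≈ y * a₂ ^ 2
    eq₂ = trans (+-congˡ (-‿cong a₁a₃≈))
            (solve 2 (λ x y → x :^ 2 :- (con (+ 1) :- y) :* x :^ 2 := y :* x :^ 2) refl a₂ y)

    eq₃ : a₁ * a₂ - a₀ * a₃ ≈ a₁ * a₂ * (x + y - x * y)
    eq₃ = trans (+-congˡ (-‿cong a₀a₃≈))
      (solve 4 (λ x y z u → x :* y :- (con (+ 1) :- z) :* (con (+ 1) :- u) :* (x :* y) := x :* y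
              :* (z :+ u :- z :* u)) refl a₁ a₂ x y)

  -- Separated from the sequence so that the two cases can present the main term differently: as -
  -- r₁ below the critical exponent and as 1 - (1 + r₁) at it.
  module Expansion
    {α : ℝ} (0<α : 0# < α) {X ρ Z : ℕ → ℝ}
    (X≈ρ+Z : Eventually (λ n → X n ≈ ρ n + Z n)) (tame : Tame Z)
    (sub-ρ : Subpolynomial ρ) (sub-∇ρ : Subpolynomial (∇ ρ))
    where

    w s X′ P G : ℕ → ℝ
    w = power (- α)
    s = step α
    X′ n = X (suc n)
    P n = ∇ X n + fromℕ n * (1# - s n) * X′ n
    G n = X n * (s n * X′ n) * (2# * (X n + s n * X′ n) - w n * (X n * (s n * X′ n)))

    X≋ρ : X ≋ ρ
    X≋ρ = congruent sub-ρ (small-cong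
      (Eventually-map (λ n e → trans (solve 2 (λ x y → x := y :+ x :- y)
              refl (Z n) (ρ n)) (+-congʳ (sym e))) X≈ρ+Z) (proj₁ tame))

    ∇X≋∇ρ : ∇ X ≋ ∇ ρ
    ∇X≋∇ρ = congruent sub-∇ρ (small-cong
      (Eventually-map (λ n e → trans
          (solve 5 (λ x y z u v → x :* (y :- z) := x :* (u :+ y :- (v :+ z)) :- x :* (u :- v))
                  refl (fromℕ n) (Z n) (Z (suc n)) (ρ n) (ρ (suc n)))
          (+-congʳ (sym e))) (∇-cong X≈ρ+Z))
      (proj₂ tame))

    X′≋ρ : X′ ≋ ρ
    X′≋ρ = ≋-trans (shift-≋ (sub-left X≋ρ) (sub-left ∇X≋∇ρ)) X≋ρ

    w≋0 : w ≋ (λ _ → 0#)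
    w≋0 = ≋-small (small-power (0<-⇒< (<-≤-trans 0<α (≈⇒≤
            (solve 1 (λ x → x := con (+ 0) :- :- x) refl α)))))

    P≋ : P ≋ (λ n → ∇ ρ n + α * ρ n)
    P≋ = ≋-+ ∇X≋∇ρ (≋-* (n*[1-step]≋γ (<⇒≤ 0<α)) X′≋ρ)

    sX′≋ρ : (λ n → s n * X′ n) ≋ ρ
    sX′≋ρ = ≋-cong (0 , λ _ _ → refl) (0 , λ n _ → *-identityˡ _) (≋-* (step≋1 (<⇒≤ 0<α)) X′≋ρ)

    -- The product x y inside the bracket carries one more factor n^(-α) and drops out; what is left
    -- is ρ² times 2 (ρ + ρ).
    G≋ : G ≋ (λ n → 2# * 2# * (ρ n * ρ n * ρ n))
    G≋ = ≋-cong (0 , λ _ _ → refl)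
      (0 , λ n _ → (solve 1 (λ x → x :* x :* (con (+ 2) :* (x :+ x) :- con (+ 0) :* (x :* x))
              := con (+ 2) :* con (+ 2) :* (x :* x :* x)) refl (ρ n)))
      (≋-* (≋-* X≋ρ sX′≋ρ)
        (≋-+ (≋-* (≋-const 2#) (≋-+ X≋ρ sX′≋ρ)) (≋-neg (≋-* w≋0 (≋-* X≋ρ sX′≋ρ)))))

    -- With x = X n / n^α and y = X (n+1) / (n+1)^α one has n (x - y) = P n / n^α,
    -- and x y (2 (x + y) - x y) = G n / n^(3 α).
    ratio-inequality : Eventually (λ n → P n * P n ≤ fromℕ n * fromℕ n * w n * G n) →
      Eventually (λ n → let x = X n * w n ; y = X (suc n) * w (suc n) in
        (x - y) * (x - y) ≤ x * y * (2# * (x + y) - x * y))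
    ratio-inequality = Eventually-map₂ (λ n 1≤n ineq →
      let N = fromℕ n
          0<N = 0<fromℕ 1≤n
          y≈ = *-congˡ (power-step α n)
          x-y≈ = +-congˡ (-‿cong y≈)
          xy≈ = *-congˡ y≈
      in ≤-respˡ-≈ (sym (*-cong x-y≈ x-y≈))
        (≤-respʳ-≈ (sym (*-cong xy≈ (+-cong (*-congˡ (+-congˡ y≈)) (-‿cong xy≈))))
          (*-cancel-≤ (0<* 0<N 0<N)
            (≤-by (0≤* (0≤x*x (w n)) (≤⇒0≤- ineq))
                    (solve 5 (λ x y z u v → x :* x :* (y :* z :* (u :* (z :* v)) :* (con (+ 2) :* (y
                    :* z :+ u :* (z :* v)) :- y :* z :* (u :* (z :* v)))) :- x :* x :* ((y :* z :- u
                    :* (z :* v)) :* (y :* z :- u :* (z :* v))) := z :* z :* (x :* x :* z :* (y :* (v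
                    :* u) :* (con (+ 2) :* (y :+ v :* u) :- z :* (y :* (v :* u)))) :- (x :* (y :- u)
                    :+ x :* (con (+ 1) :- v) :* u) :* (x :* (y :- u) :+ x :* (con (+ 1) :- v)
                    :* u))) refl N (X n) (w n) (X′ n) (s n))))))
      positive

    n²w≈power : ∀ n → 1 ℕ.≤ n → fromℕ n * fromℕ n * w n ≈ power (2# - α) n
    n²w≈power n 1≤n = trans
      (*-congʳ (trans (sym (*-cong (power-1 n 1≤n) (power-1 n 1≤n))) (sym (power-+ 1# 1# n))))
      (sym (power-+ 2# (- α) n))

    -- With θ = (2 - α) / 2 the available factor n^(2 - α) is (n^θ)². One n^θ bounds P², the other
    -- compensates ρ³ ≥ n^(-θ); the error of G costs at most one of its four ρ³.
    below-critical : α < 2# → NotPowerSmall ρ → Eventually (λ n → P n * P n ≤ fromℕ n * fromℕ n * w n * G n)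
    below-critical α<2 ρ-large = Eventually-map₂
      (λ n (1≤n , P≤) (ν≤ , ≤ρ³) →
        let p = power θ n
            m = power (- θ) n
            c = ρ n * ρ n * ρ n
            ν = G n - 2# * 2# * c
            0≤p = 0≤power θ n
        in ≤-trans (≤-trans (x≤∣x∣ _) P≤)
          (≤-respʳ-≈ (*-congʳ (sym (trans (n²w≈power n 1≤n) (sym (power-half _ n)))))
            (≤-by (0≤+ (0≤+ (0≤+ (0≤* 0≤p (≤⇒0≤- (≈⇒≥ (power-inverse θ n)))) (0≤* (0≤* 0≤p 0≤p)
                    (≤⇒0≤- ≤ρ³))) (0≤* (0≤* 0≤p 0≤p) (≤⇒0≤- (≤-trans (-x≤∣x∣ _) ν≤)))) (0≤* (0≤*
                    (0≤* (0≤ℕ 2) 0≤p) 0≤p) (≤-trans (0≤power (- θ) n) ≤ρ³)))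
                    (solve 4 (λ x y z u → x :* x :* y :- x := x :* (x :* z :- con (+ 1)) :+ x :* x
                    :* (u :- z) :+ x :* x :* (u :- :- (y :- con (+ 2) :* con (+ 2) :* u))
                    :+ con (+ 2) :* x :* x :* u) refl p (G n) m c))))
      (Eventually-∧ positive (Subpolynomial.bound (sub-* (sub-left P≋) (sub-left P≋)) θ 0<θ))
      (Eventually-∧ (small≤notSmall (_≋_.difference G≋) ρ³-large) (NotPowerSmall.bound ρ³-large θ 0<θ))
      where
      θ = half (2# - α)

      0<θ : 0# < θ
      0<θ = 0<half (<⇒0<- α<2)

      ρ³-large : NotPowerSmall (λ n → ρ n * ρ n * ρ n)
      ρ³-large = notSmall-* (notSmall-* ρ-large ρ-large) ρ-large

    -- Here n^(2 - α) = 1 and no power is left to spend. To first order in δ, the margin 4 δ loses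
    -- at most 2 δ to 4 ρ ∇ρ, because 2 ∣ ∇ρ ∣ ≤ δ, and at most δ to the errors, so δ remains.
    critical : α ≈ 2# → {δ : ℕ → ℝ} → (∀ n → ρ n ≈ 1# + δ n) → NotPowerSmall δ →
               Eventually (λ n → 2# * ∣ ∇ ρ n ∣ ≤ δ n) →
               Eventually (λ n → P n * P n ≤ fromℕ n * fromℕ n * w n * G n)
    critical α≈2 {δ} ρ≈1+δ δ-large ∇ρ≤δ = Eventually-map₂
      (λ n (1≤n , 2t≤δ) (ν≤ , δ-lower) →
        let d = δ n
            D = ∇ ρ n
            t = ∣ D ∣
            q = D + α * ρ n
            c = ρ n * ρ n * ρ n
            -- The errors of both sides in one term, to be compared with δ once.
            ν = P n * P n - q * q - (G n - 2# * 2# * c)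
            q≈ = +-congˡ {D} (*-cong α≈2 (ρ≈1+δ n))
            c≈ = *-congˡ {2# * 2#} (*-cong (*-cong (ρ≈1+δ n) (ρ≈1+δ n)) (ρ≈1+δ n))
            ν≤d = ≤-trans (x≤∣x∣ _) ν≤
            0≤d = ≤-trans (0≤power _ n) δ-lower
            estimate = (≤-by (0≤+ (0≤+ (0≤+ (0≤+ (0≤+ (0≤+ (0≤+ (0≤+ (0≤+ (0≤* (≤⇒0≤- (x≤∣x∣ D))
                    (≤⇒0≤- (-x≤∣x∣ D))) (0≤* (0≤* (0≤ℕ 4) (0≤+ 0≤1 0≤d)) (≤⇒0≤- (x≤∣x∣ D)))) (0≤*
                    (0≤* (0≤ℕ 2) (0≤+ 0≤1 0≤d)) (≤⇒0≤- 2t≤δ))) (0≤* (≤⇒0≤- 2t≤δ) (0≤+ 0≤d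
                    (0≤∣x∣ D)))) (0≤* (0≤∣x∣ D) 0≤d)) (0≤* (0≤∣x∣ D) (0≤∣x∣ D))) (≤⇒0≤- ν≤d)) 0≤d)
                    (0≤* (0≤* (0≤ℕ 5) 0≤d) 0≤d)) (0≤* (0≤* (0≤* (0≤ℕ 4) 0≤d) 0≤d) 0≤d))
                    (solve 4 (λ x y z u → con (+ 2) :* con (+ 2) :* ((con (+ 1) :+ x) :* (con (+ 1)
                    :+ x) :* (con (+ 1) :+ x)) :- (y :+ con (+ 2) :* (con (+ 1) :+ x)) :* (y
                    :+ con (+ 2) :* (con (+ 1) :+ x)) :- z := (u :- y) :* (u :- :- y) :+ con (+ 4)
                    :* (con (+ 1) :+ x) :* (u :- y) :+ con (+ 2) :* (con (+ 1) :+ x) :* (x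
                    :- con (+ 2) :* u) :+ (x :- con (+ 2) :* u) :* (x :+ u) :+ u :* x :+ u :* u
                    :+ (x :- z) :+ x :+ con (+ 5) :* x :* x :+ con (+ 4) :* x :* x :* x)
                    refl d D ν t))
        in ≤-respʳ-≈ (sym (trans (*-congʳ (trans (n²w≈power n 1≤n)
               (trans (power-cong n (trans (+-congˡ (-‿cong α≈2)) (-‿inverseʳ 2#))) (power-0 n)))) (*-identityˡ _)))
          (≤-by (≤⇒0≤- (≤-respʳ-≈ (+-cong (sym c≈) (-‿cong (sym (*-cong q≈ q≈)))) estimate))
                  (solve 4 (λ x y z u → x :- y := con (+ 2) :* con (+ 2) :* z :- u :* u :- (y :- u
                  :* u :- (x :- con (+ 2) :* con (+ 2) :* z))) refl (G n) (P n * P n) c q)))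
      (Eventually-∧ positive ∇ρ≤δ)
      (Eventually-∧ (small≤notSmall (small-+ (_≋_.difference (≋-* P≋ P≋)) (small-neg (_≋_.difference G≋))) δ-large)
                    -- Any exponent serves: only 0 ≤ δ is read off.
                    (NotPowerSmall.bound δ-large 1# 0<1))

  -- The expansion of the given sequence and the two cases

  module _
    (a : ℕ → ℝ) (a≉0 : Eventually (λ n → a n ≉ 0#))
    (k : ℕ) (r : Fin (suc k) → RationalFunction) (α : Fin (suc k) → ℝ) (β : ℝ)
    (0<α₀ : 0# < α Fin.zero)
    (α-increasing : ∀ i j → i Fin.< j → α i < α j)
    (α<β : α (Fin.fromℕ k) < β)
    (expansion : RatioExpansion E a (suc k) r α β)
    (gap : 1# ≤ α (Fin.fromℕ k) - α Fin.zero)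
    where

    -- Indices in `Fin` start at 0, so this is the α₁ of the expansion.
    α₀ : ℝ
    α₀ = α Fin.zero

    term : Fin (suc k) → ℕ → ℝ
    term i n = eval (r i) (L n) / power (α i) n

    u err X Z : ℕ → ℝ
    u n = a (n ℕ.∸ 1) * a (suc n) / a n ^ 2
    err n = u n - (1# + sum (λ i → term i n))
    X n = (1# - u n) * power α₀ n
    Z n = - (sum (λ i → term (Fin.suc i) n * power α₀ n)) + - (err n * power α₀ n)

    tame-higher-term : ∀ i → Tame (λ n → term (Fin.suc i) n * power α₀ n)
    tame-higher-term i = tame-cong
      (0 , λ n _ → let e = eval (r (Fin.suc i)) (L n) in
        trans (*-congˡ (trans (power-cong n
                (solve 2 (λ x y → :- (x :- y) := :- x :+ y) refl (α (Fin.suc i)) α₀))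
            (trans (power-+ (- α (Fin.suc i)) α₀ n) (*-congʳ (sym (power-⁻¹ (α (Fin.suc i)) n))))))
          (sym (*-assoc e _ _)))
      (tame-term (r (Fin.suc i)) (<⇒0<- (α-increasing Fin.zero (Fin.suc i) (ℕ.s≤s ℕ.z≤n))))

    -- With ε = 1 in the o-term, n times this error is at most n^(1 + α₀ - β), and 1 + α₀ ≤ α_m < β
    -- makes the exponent negative.
    tame-error : Tame (λ n → err n * power α₀ n)
    tame-error = tame-by-multiple (small-≤
      (Eventually-map₂
        (λ n 1≤n err≤ → ≤-respʳ-≈ (sym (∣power∣ _ n)) (≤-trans
          (∣x*y∣≤ (≈⇒≤ (0≤x⇒∣x∣≈x (0≤fromℕ n)))
            (∣x*y∣≤ (≤-respˡ-≈ (∣∣-cong (+-congʳ (reflexive (ratio-≡ n)))) (≤-trans err≤ (≈⇒≤ (bound≈ n)))) (≈⇒≤ (∣power∣ α₀ n))))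
          (≈⇒≤ (trans (*-cong (sym (power-1 n 1≤n)) (trans (*-comm _ _) (sym (power-+ α₀ (- β) n))))
            (sym (power-+ 1# (α₀ - β) n))))))
        positive (expansion 1# 0<1))
      (small-power {1# + (α₀ - β)} (0<-⇒< (≤-<-trans (≤⇒0≤- gap) (0<-⇒< (<-≤-trans (<⇒0<- α<β) (≈⇒≤
        (solve 3 (λ x y z → x :- y := con (+ 0) :- (con (+ 1) :+ (z :- x)) :- (y :- z :- con (+ 1)))
                refl β (α (Fin.fromℕ k)) α₀))))))))
      where
      -- `n ℕ.+ 1` does not reduce to `suc n`.
      ratio-≡ : ∀ n → a (n ℕ.∸ 1) * a (n ℕ.+ 1) / a n ^ 2 ≡ u n
      ratio-≡ n = ≡.cong (λ j → a (n ℕ.∸ 1) * a j / a n ^ 2) (ℕ.+-comm n 1)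

      bound≈ : ∀ n → 1# * ∣ 1# / power β n ∣ ≈ power (- β) n
      bound≈ n = trans (*-identityˡ _) (trans (∣∣-cong (trans (*-identityˡ _) (power-⁻¹ β n))) (∣power∣ (- β) n))

    tame-Z : Tame Z
    tame-Z = tame-+ (tame-neg (tame-sum (λ i n → term (Fin.suc i) n * power α₀ n) tame-higher-term)) (tame-neg tame-error)

    X≈ : ∀ n → X n ≈ - eval (r Fin.zero) (L n) + Z n
    X≈ n = trans
      (solve 5 (λ x y z u v → (con (+ 1) :- x) :* y := :- (z :* u :* y) :+ (:- (v :* y) :+ :- ((x
              :- (con (+ 1) :+ (z :* u :+ v))) :* y))) refl (u n) p e (p ⁻¹) S)
      (+-cong (-‿cong (/-cancel e (0<⇒≉0 (0<power α₀ n)))) (+-congʳ (-‿cong (*-distribʳ-sum p (λ i → term (Fin.suc i) n)))))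
      where
      p = power α₀ n
      e = eval (r Fin.zero) (L n)
      S = sum (λ i → term (Fin.suc i) n)

    conclude : Eventually (λ n → let x = X n * power (- α₀) n ; y = X (suc n) * power (- α₀) (suc n) in
                 (x - y) * (x - y) ≤ x * y * (2# * (x + y) - x * y)) →
               SatisfiesHigherOrderTuránAsymptotically a
    conclude = Eventually-map₂
      (λ n (a₁≉0 , a₂≉0) ineq → ≡.subst₂
        (λ i j → 0# ≤ fromℕ 4 * ((a n ^ 2 - a (n ℕ.∸ 1) * a i) * (a i ^ 2 - a n * a j)) - (a n * a i - a (n ℕ.∸ 1) * a j) ^ 2)
        (ℕ.+-comm 1 n) (ℕ.+-comm 2 n)
        (turán-by-ratios a₁≉0 a₂≉0 (x≈ n) (x≈ (suc n)) ineq))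
      (Eventually-∧ a≉0 (Eventually-suc a≉0))
      where
      x≈ : ∀ n → 1# - u n ≈ X n * power (- α₀) n
      x≈ n = sym (trans (*-assoc _ _ _) (trans (*-congˡ (power-inverse α₀ n)) (*-identityʳ _)))

    below-critical-case : α₀ < fromℕ 2 → EventuallyReal (λ x → eval (r Fin.zero) x < 0#) →
                          SatisfiesHigherOrderTuránAsymptotically a
    below-critical-case α₀<2 r<0 = conclude (ratio-inequality (below-critical
        (<-≤-trans α₀<2 (≈⇒≤ (solve 1 (λ x → con (+ 1) :+ (con (+ 1) :+ con (+ 0)) := con (+ 2))
                refl 0#))) (notSmall-eval (r Fin.zero) r<0)))
      where
      ρ : ℕ → ℝ
      ρ n = - eval (r Fin.zero) (L n)

      X≈ρ+Z : Eventually (λ n → X n ≈ ρ n + Z n)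
      X≈ρ+Z = 0 , λ n _ → X≈ n

      open Expansion 0<α₀ {X} {ρ} {Z} X≈ρ+Z tame-Z
        (sub-neg (sub-eval (r Fin.zero))) (sub-∇neg (sub-∇eval (r Fin.zero)))

    -- Here the slow variation of 1 + r₁ is needed and not only that of r₁, since
    -- r₁ may tend to -1.
    critical-case : α₀ ≈ fromℕ 2 → EventuallyReal (λ x → eval (r Fin.zero) x < - 1#) →
                    SatisfiesHigherOrderTuránAsymptotically a
    critical-case α₀≈2 r<-1 = conclude (ratio-inequality (critical
        (trans α₀≈2 (solve 1 (λ x → con (+ 1) :+ (con (+ 1) :+ con (+ 0)) := con (+ 2))
                refl 0#)) (λ n → refl) (notSmall-eval (1+ r Fin.zero) 1+r<0) 2∣∇ρ∣≤-g))
      where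
      g ρ : ℕ → ℝ
      g n = eval (1+ r Fin.zero) (L n)
      ρ n = 1# + - g n

      1+r<0 : EventuallyReal (λ x → eval (1+ r Fin.zero) x < 0#)
      1+r<0 = EventuallyReal-map
        (λ x (r<-1 , e) → ≤-<-trans (≈⇒≤ e) (0<-⇒< (<-≤-trans (<⇒0<- r<-1)
          (≈⇒≤ (solve 1 (λ x → :- con (+ 1) :- x := con (+ 0) :- (con (+ 1) :+ x))
                  refl (eval (r Fin.zero) x))))))
        (EventuallyReal-∧ r<-1 (eval-1+ (r Fin.zero)))

      ∇ρ≈ : ∀ n → ∇ (λ n → - g n) n ≈ ∇ ρ n
      ∇ρ≈ n = (solve 3 (λ x y z → x :* (:- y :- :- z) := x :* (con (+ 1) :+ :- y :- (con (+ 1) :+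
              :- z))) refl (fromℕ n) (g n) (g (suc n)))

      2∣∇ρ∣≤-g : Eventually (λ n → 2# * ∣ ∇ ρ n ∣ ≤ - g n)
      2∣∇ρ∣≤-g = Eventually-map₂
        (λ n slow g<0 →
          (≤-by (0≤+ (0≤+ (0≤* (0≤ℕ 2) (≤⇒0≤-
                  (≤-respˡ-≈ (trans (sym (∣-x∣≈∣x∣ _)) (∣∣-cong (trans (sym (∇-neg g n)) (∇ρ≈ n)))) slow)))
                  (0≤* (≤⇒0≤- (≈⇒≤ (half+half 1#))) (0≤∣x∣ (g n))))
                  (≤⇒0≤- (≈⇒≤ (x≤0⇒∣x∣≈-x (<⇒≤ g<0)))))
                  (solve 4 (λ x y z u → :- x :- con (+ 2) :* y := con (+ 2) :* (z :* u :- y)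
                  :+ (con (+ 1) :- (z :+ z)) :* u :+ (:- x :- u))
                  refl (g n) (∣ ∇ ρ n ∣) (half 1#) (∣ g n ∣))))
        -- ε = 1/2 is the ratio that `critical` asks for.
        (slow-along-L (eval-slow (1+ r Fin.zero)) (0<half 0<1)) (eventually-log 1+r<0)

      X≈ρ+Z : Eventually (λ n → X n ≈ ρ n + Z n)
      X≈ρ+Z = Eventually-map (λ n e → trans (X≈ n) (+-congʳ (trans
          (solve 1 (λ x → :- x := con (+ 1) :+ :- (con (+ 1) :+ x))
                  refl (eval (r Fin.zero) (L n))) (+-congˡ (-‿cong (sym e))))))
        (eventually-log (eval-1+ (r Fin.zero)))

      sub-ρ : Subpolynomial ρ
      sub-ρ = sub-+ (sub-const 1#) (sub-neg (sub-eval (1+ r Fin.zero)))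

      sub-∇ρ : Subpolynomial (∇ ρ)
      sub-∇ρ = sub-cong (0 , λ n _ → ∇ρ≈ n) (sub-∇neg (sub-∇eval (1+ r Fin.zero)))

      open Expansion 0<α₀ {X} {ρ} {Z} X≈ρ+Z tame-Z sub-ρ sub-∇ρ

theorem2p2 : ExcludedMiddle 0ℓ → (R : RealNumbers) → let open RealNumbers R in
    (E : ExpLog)
    (a : ℕ → ℝ) → Eventually (λ n → a n ≉ 0#) →
    (k : ℕ) → let m = suc k in
    (r : Fin m → RationalFunction) (α : Fin m → ℝ) (β : ℝ) →
    0# < α Fin.zero →
    (∀ i j → i Fin.< j → α i < α j) →
    α (Fin.fromℕ k) < β →
    RatioExpansion E a m r α β →
    1# ≤ α (Fin.fromℕ k) - α Fin.zero →
    ((0# < α Fin.zero × α Fin.zero < fromℕ 2 × EventuallyReal (λ x → eval (r Fin.zero) x < 0#))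
    ⊎ (α Fin.zero ≈ fromℕ 2 × EventuallyReal (λ x → eval (r Fin.zero) x < - 1#))) →
    SatisfiesHigherOrderTuránAsymptotically a
theorem2p2 em R E a a≉0 k r α β 0<α₀ increasing α<β expansion gap =
  λ { (inj₁ (_ , α₀<2 , r<0)) → below-critical-case a a≉0 k r α β 0<α₀ increasing α<β expansion gap α₀<2 r<0
    ; (inj₂ (α₀≈2 , r<-1))    → critical-case a a≉0 k r α β 0<α₀ increasing α<β expansion gap α₀≈2 r<-1 }
  where open Turán em R E
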